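{- Let $q$ be a prime power, let $n,k$ be positive integers with $n\geq 2k+1$, let $t\in\{0,1,\dots,k-1\}$ and $S=\{0,1,\dots,t\}$. Then \[Z(J_{q,S}(n,k))\geq\binom{n}{k}_q-\binom{2k-2t}{k-t}.\]
   Context: For a prime power $q$, $\mathbb{F}_q$ is the finite field of order $q$. For $S\subseteq\{0,1,\dots,k-1\}$, the generalized Grassmann graph $J_{q,S}(n,k)$ is the simple graph whose vertices are the $k$-dimensional subspaces of $\mathbb{F}_q^n$, two distinct vertices being adjacent if and only if the dimension of their intersection lies in $S$. $\binom{n}{k}_q=\prod_{i=0}^{k-1}\frac{1-q^{n-i}}{1-q^{i+1}}$ is the Gaussian binomial coefficient (the number of vertices). Zero forcing on a graph $G$: start with a set of black vertices, all others white; repeatedly, if a black vertex $v$ has exactly one white neighbor $w$, color $w$ black. A zero forcing set is an initial black set for which this eventually colors all vertices black; $Z(G)$ is the minimum size of a zero forcing set. -}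

module Defs where

open import Data.Nat using (ℕ; zero; suc; _+_; _*_; _^_; _≤_)
open import Data.Fin using (Fin) renaming (zero to fzero; suc to fsuc)
open import Data.Vec using (Vec; zipWith; map; replicate)
open import Data.Bool using (Bool; true; false; _∧_)
open import Data.Product using (Σ; _×_; ∃; ∃-syntax; proj₁)
open import Data.List using (List)
open import Data.List.Relation.Unary.Any using (Any)
open import Data.List.Relation.Unary.AllPairs using (AllPairs)
open import Relation.Binary.PropositionalEquality using (_≡_)
open import Relation.Nullary using (¬_)
open import Algebra.Structures using (IsCommutativeRing)

-- A finite field of order q, realised on the carrier Fin q.
-- (Every field with q elements is isomorphic to one of these, so
-- quantifying over such structures is quantifying over 𝔽_q.)

record FiniteField (q : ℕ) : Set where
  field
    _+F_ _*F_ : Fin q → Fin q → Fin q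
    -F_       : Fin q → Fin q
    0F 1F     : Fin q
    isCommutativeRing : IsCommutativeRing _≡_ _+F_ _*F_ -F_ 0F 1F
    0≢1       : ¬ (0F ≡ 1F)
    inverse   : (x : Fin q) → ¬ (x ≡ 0F) → ∃[ y ] (x *F y ≡ 1F)

module LinearAlgebra {q : ℕ} (F : FiniteField q) (n : ℕ) where
  open FiniteField F

  V : Set
  V = Vec (Fin q) n

  0V : V
  0V = replicate n 0F

  _+V_ : V → V → V
  _+V_ = zipWith _+F_

  _·V_ : Fin q → V → V
  c ·V x = map (c *F_) x

  lincomb : {d : ℕ} → (Fin d → Fin q) → (Fin d → V) → V
  lincomb {zero}  c b = 0V
  lincomb {suc d} c b = (c fzero ·V b fzero) +V lincomb (λ i → c (fsuc i)) (λ i → b (fsuc i))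

  LinearlyIndependent : {d : ℕ} → (Fin d → V) → Set
  LinearlyIndependent b = ∀ c → lincomb c b ≡ 0V → ∀ i → c i ≡ 0F

  record Subspace : Set where
    field
      mem      : V → Bool
      has-zero : mem 0V ≡ true
      add-closed  : ∀ x y → mem x ≡ true → mem y ≡ true → mem (x +V y) ≡ true
      smul-closed : ∀ c x → mem x ≡ true → mem (c ·V x) ≡ true
  open Subspace public

  HasDim : Subspace → ℕ → Set
  HasDim U d = Σ (Fin d → V) λ b →
      LinearlyIndependent b
    × (∀ i → mem U (b i) ≡ true)
    × (∀ x → mem U x ≡ true → ∃[ c ] (lincomb c b ≡ x))

  _∩_ : Subspace → Subspace → Subspace
  U ∩ W = record
    { mem = λ x → mem U x ∧ mem W x
    ; has-zero = ∧-intro (has-zero U) (has-zero W)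
    ; add-closed = λ x y px py → ∧-intro (add-closed U x y (∧-l px) (∧-l py)) (add-closed W x y (∧-r px) (∧-r py))
    ; smul-closed = λ c x px → ∧-intro (smul-closed U c x (∧-l px)) (smul-closed W c x (∧-r px))
    }
    where
    open import Relation.Binary.PropositionalEquality using (refl)
    ∧-intro : ∀ {a b} → a ≡ true → b ≡ true → (a ∧ b) ≡ true
    ∧-intro refl refl = refl
    ∧-l : ∀ {a b} → (a ∧ b) ≡ true → a ≡ true
    ∧-l {true} _ = refl
    ∧-l {false} ()
    ∧-r : ∀ {a b} → (a ∧ b) ≡ true → b ≡ true
    ∧-r {true} p = p
    ∧-r {false} ()

  _≈S_ : Subspace → Subspace → Set
  U ≈S W = ∀ x → mem U x ≡ mem W x

  Vertex : ℕ → Set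
  Vertex k = Σ Subspace λ U → HasDim U k

  _≈_ : {k : ℕ} → Vertex k → Vertex k → Set
  U ≈ W = proj₁ U ≈S proj₁ W

  AdjJ : (S : ℕ → Set) {k : ℕ} → Vertex k → Vertex k → Set
  AdjJ S U W = ¬ (U ≈ W) × ∃[ d ] (S d × HasDim (proj₁ U ∩ proj₁ W) d)

module ZeroForcing {A : Set} (_≈_ : A → A → Set) (Adj : A → A → Set) where

  -- the vertices that end up black when starting from the black set B:
  -- v becomes black if some black u is adjacent to v and every neighbour
  -- of u other than v is black (i.e. v is u's only white neighbour).
  data Black (B : A → Set) : A → Set where
    initial : ∀ {v} → B v → Black B v
    force   : ∀ {v} (u : A) → Black B u → Adj u v
            → (∀ w → Adj u w → ¬ (w ≈ v) → Black B w) → Black B v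

  _∈L_ : A → List A → Set
  v ∈L L = Any (λ b → b ≈ v) L

  Distinct : List A → Set
  Distinct = AllPairs (λ a b → ¬ (a ≈ b))

  IsZeroForcingSet : List A → Set
  IsZeroForcingSet L = ∀ v → Black (_∈L L) v

-- Gaussian binomial coefficient via the q-Pascal recursion
-- [n+1, k+1]_q = [n, k]_q + q^(k+1) [n, k+1]_q

gauss : ℕ → ℕ → ℕ → ℕ
gauss q n       zero    = 1
gauss q zero    (suc k) = 0
gauss q (suc n) (suc k) = gauss q n k + q ^ suc k * gauss q n (suc k)

{-# OPTIONS --safe #-}

-- Idea. If the i-th force is uᵢ → vᵢ, then dim (uᵢ ∩ vᵢ) ≤ t, while
-- dim (uᵢ ∩ vⱼ) > t for i < j because vⱼ is still white at time i. So the
-- number of forces, which is the number of vertices minus |B|, is at most the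
-- bound C(2r, r), r = k - t, of the skew Bollobás theorem for subspaces with
-- threshold t.
--
-- General position, unavailable over a finite field, is obtained over an iterated
-- power series ring. Cutting t times with the generic hyperplane (1, x, x², …)⊥
-- makes the intersections uᵢ ∩ vᵢ trivial and leaves the uᵢ ∩ vⱼ nonzero, with
-- r-dimensional spaces; then projecting along generic vectors (1, x, x², …) brings
-- the ambient dimension down to 2r. There the products ⋀vⱼ lie in Λʳ, of rank
-- C(2r, r), and are independent: ⋀uᵢ ∧ ⋀vⱼ vanishes for i < j but not for i = j.
-- Rings are kept as integral domains and no fractions are formed.

module Submission where

open import Defs
open import Algebra using (CommutativeRing)
import Algebra.Construct.Pointwise as Pointwise
open import Algebra.Solver.Ring.AlmostCommutativeRing using (fromCommutativeRing; _-Raw-AlmostCommutative⟶_)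
open import Data.Bool as Bool using (Bool; true; false; _∧_)
open import Data.Fin as Fin using (Fin; zero; suc; toℕ; _↑ˡ_; _↑ʳ_; splitAt; remQuot; finToFun; funToFin)
open import Data.Fin.Induction using (<-wellFounded)
import Data.Fin.Properties as Fin
open import Data.Fin.Subset using (∣_∣)
open import Data.Fin.Subset.Properties using (∣p∣≤n)
open import Data.Integer as ℤ using (ℤ)
import Data.Integer.Properties as ℤ
open import Data.List as List using (List; _∷_; length)
open import Data.List.Relation.Unary.Any using (here; there; any?; index)
open import Data.List.Relation.Unary.Any.Properties using (lookup-index)
open import Data.Maybe using (map)
open import Data.Nat as ℕ using (ℕ; zero; suc; _≤_; _<_; s≤s; z≤n)
open import Data.Nat.Combinatorics using (_C_; nCk+nC[k+1]≡[n+1]C[k+1]; nCn≡1; nCk≡nC[n∸k])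
import Data.Nat.Properties as ℕ
open import Data.Product using (Σ; _×_; _,_; proj₁; proj₂; ∃; ∃-syntax)
open import Data.Sum using (_⊎_; inj₁; inj₂)
open import Data.Vec using (Vec; []; _∷_; replicate; lookup; tabulate)
import Data.Vec.Properties as Vec
open import Function using (_∘_)
open import Induction.WellFounded using (Acc; acc)
open import Level using (0ℓ)
open import Relation.Binary.Definitions using (tri<; tri≈; tri>) renaming (Decidable to Decidable₂)
open import Relation.Binary.PropositionalEquality as ≡ using (_≡_)
open import Relation.Nullary using (¬_; yes; no; contradiction; Dec; ¬?; does)
open import Relation.Nullary.Decidable using (decidable-stable; dec⇒maybe; dec-true; map′; _×-dec_)
open import Relation.Unary using (Decidable)

-- What makes (1, x, x², ...) generic is that it satisfies no nonzero linear equation with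
-- coefficients in the base ring (`generic-injective`); cutting and projecting both reduce to this.
-- Each such step turns its input into constants of a new series ring, so the rings are nested and
-- every bound is stated for an arbitrary `Domain`. Power series are plain coefficient functions
-- without normal forms; the price is undecidable equality. Elimination would have to decide which
-- pivots vanish, so dimension arguments go through the exterior algebra instead (`many⇒¬Indep`).
--
-- The numbers sᵢ = dim (uᵢ ∩ vᵢ) may differ and lie below t. They are carried by pairs of bases
-- that agree in their first sᵢ vectors. The condition on uᵢ ∩ vⱼ is only a lower bound and is
-- carried by explicit independent vectors.
--
-- On the counting side, `gauss q n k` pairwise distinct vertices suffice: if |B| is smaller than
-- claimed, one of them is still white at each of C(2r, r) + 1 successive forces, which is one force
-- too many.

-- The standard library's ring solver only cancels x - x when its coefficient
-- ring has decidable equality, so the coefficients are taken in ℤ.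
module IntegerSolver (R : CommutativeRing 0ℓ 0ℓ) where
  open import Data.Integer using (+_; -[1+_])
  open CommutativeRing R
  open import Algebra.Properties.Semiring.Mult semiring using (×-homo-+; ×1-homo-*) renaming (_×_ to _×ᴿ_)
  open import Algebra.Properties.Ring ring
  open import Algebra.Properties.AbelianGroup +-abelianGroup using (⁻¹-∙-comm)
  open import Algebra.Properties.CommutativeSemigroup +-commutativeSemigroup using (interchange)
  open import Relation.Binary.Reasoning.Setoid setoid

  private
    ⟦_⟧ : ℤ → Carrier
    ⟦ + n ⟧      = n ×ᴿ 1#
    ⟦ -[1+ n ] ⟧ = - (suc n ×ᴿ 1#)

    ⊖-homo : ∀ m n → ⟦ m ℤ.⊖ n ⟧ ≈ m ×ᴿ 1# - n ×ᴿ 1#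
    ⊖-homo zero    zero    = sym (-‿inverseʳ 0#)
    ⊖-homo zero    (suc n) = sym (+-identityˡ _)
    ⊖-homo (suc m) zero    = sym (trans (+-congˡ -0#≈0#) (+-identityʳ _))
    ⊖-homo (suc m) (suc n) = begin
      ⟦ suc m ℤ.⊖ suc n ⟧                  ≡⟨ ≡.cong ⟦_⟧ (ℤ.[1+m]⊖[1+n]≡m⊖n m n) ⟩
      ⟦ m ℤ.⊖ n ⟧                          ≈⟨ ⊖-homo m n ⟩
      m ×ᴿ 1# - n ×ᴿ 1#                      ≈⟨ +-identityˡ _ ⟨
      0# + (m ×ᴿ 1# - n ×ᴿ 1#)               ≈⟨ +-congʳ (-‿inverseʳ 1#) ⟨
      (1# - 1#) + (m ×ᴿ 1# - n ×ᴿ 1#)        ≈⟨ interchange _ _ _ _ ⟩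
      (1# + m ×ᴿ 1#) + (- 1# + - (n ×ᴿ 1#))  ≈⟨ +-congˡ (⁻¹-∙-comm _ _) ⟩
      suc m ×ᴿ 1# - suc n ×ᴿ 1#              ∎

    +-homo : ∀ i j → ⟦ i ℤ.+ j ⟧ ≈ ⟦ i ⟧ + ⟦ j ⟧
    +-homo (+ m)      (+ n)      = ×-homo-+ 1# m n
    +-homo (+ m)      (-[1+ n ]) = ⊖-homo m (suc n)
    +-homo (-[1+ m ]) (+ n)      = trans (⊖-homo n (suc m)) (+-comm _ _)
    +-homo (-[1+ m ]) (-[1+ n ]) = begin
      - (suc (suc (m ℕ.+ n)) ×ᴿ 1#)       ≡⟨ ≡.cong (λ z → - (suc z ×ᴿ 1#)) (ℕ.+-suc m n) ⟨
      - ((suc m ℕ.+ suc n) ×ᴿ 1#)         ≈⟨ -‿cong (×-homo-+ 1# (suc m) (suc n)) ⟩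
      - (suc m ×ᴿ 1# + suc n ×ᴿ 1#)        ≈⟨ ⁻¹-∙-comm _ _ ⟨
      - (suc m ×ᴿ 1#) + - (suc n ×ᴿ 1#)    ∎

    -‿homo : ∀ i → ⟦ ℤ.- i ⟧ ≈ - ⟦ i ⟧
    -‿homo (+ zero)   = sym -0#≈0#
    -‿homo (+ suc n)  = refl
    -‿homo (-[1+ n ]) = sym (-‿involutive _)

    *-homo⁺ : ∀ m j → ⟦ + m ℤ.* j ⟧ ≈ ⟦ + m ⟧ * ⟦ j ⟧
    *-homo⁺ m (+ n) = trans (reflexive (≡.cong ⟦_⟧ (≡.sym (ℤ.pos-* m n)))) (×1-homo-* m n)
    *-homo⁺ m (-[1+ n ]) = begin
      ⟦ + m ℤ.* (ℤ.- (+ suc n)) ⟧   ≡⟨ ≡.cong ⟦_⟧ (ℤ.neg-distribʳ-* (+ m) (+ suc n)) ⟨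
      ⟦ ℤ.- (+ m ℤ.* + suc n) ⟧     ≈⟨ -‿homo (+ m ℤ.* + suc n) ⟩
      - ⟦ + m ℤ.* + suc n ⟧         ≈⟨ -‿cong (*-homo⁺ m (+ suc n)) ⟩
      - (⟦ + m ⟧ * ⟦ + suc n ⟧)     ≈⟨ -‿distribʳ-* _ _ ⟩
      ⟦ + m ⟧ * - ⟦ + suc n ⟧       ∎

    *-homo : ∀ i j → ⟦ i ℤ.* j ⟧ ≈ ⟦ i ⟧ * ⟦ j ⟧
    *-homo (+ m) j = *-homo⁺ m j
    *-homo (-[1+ m ]) j = begin
      ⟦ (ℤ.- (+ suc m)) ℤ.* j ⟧     ≡⟨ ≡.cong ⟦_⟧ (ℤ.neg-distribˡ-* (+ suc m) j) ⟨
      ⟦ ℤ.- (+ suc m ℤ.* j) ⟧       ≈⟨ -‿homo (+ suc m ℤ.* j) ⟩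
      - ⟦ + suc m ℤ.* j ⟧           ≈⟨ -‿cong (*-homo⁺ (suc m) j) ⟩
      - (⟦ + suc m ⟧ * ⟦ j ⟧)       ≈⟨ -‿distribˡ-* _ _ ⟩
      - ⟦ + suc m ⟧ * ⟦ j ⟧         ∎

    morphism : ℤ.+-*-rawRing -Raw-AlmostCommutative⟶ fromCommutativeRing R
    morphism = record
      { ⟦_⟧ = ⟦_⟧ ; +-homo = +-homo ; *-homo = *-homo ; -‿homo = -‿homo
      ; 0-homo = refl ; 1-homo = +-identityʳ 1# }

  open import Algebra.Solver.Ring ℤ.+-*-rawRing (fromCommutativeRing R) morphism
    (λ i j → map (λ i≡j → reflexive (≡.cong ⟦_⟧ i≡j)) (dec⇒maybe (i ℤ.≟ j))) public
    using (Polynomial; solve; con; _:+_; _:*_; _:-_; :-_; _:=_)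

  :0 : ∀ {n} → Polynomial n
  :0 = con (+ 0)

-- Equality in the power series rings below is not decidable; stability under
-- double negation is what is needed to argue about vanishing by contradiction.
record Domain : Set₁ where
  field
    commutativeRing : CommutativeRing 0ℓ 0ℓ
  open CommutativeRing commutativeRing public hiding (zero)
  field
    1≉0      : ¬ 1# ≈ 0#
    ≈-stable : ∀ {x y} → ¬ ¬ x ≈ y → x ≈ y
    *-cancel : ∀ {x y} → ¬ x ≈ 0# → x * y ≈ 0# → y ≈ 0#

-- Concatenated families, and subsets of a given size

append : ∀ {A : Set} {m n} → (Fin m → A) → (Fin n → A) → Fin (m ℕ.+ n) → A
append {m = zero}  f g i       = g i
append {m = suc m} f g zero    = f zero
append {m = suc m} f g (suc i) = append (f ∘ suc) g i

append-↑ˡ : ∀ {A : Set} {m n} (f : Fin m → A) (g : Fin n → A) i → append f g (i ↑ˡ n) ≡ f i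
append-↑ˡ f g zero    = ≡.refl
append-↑ˡ f g (suc i) = append-↑ˡ (f ∘ suc) g i

append-↑ʳ : ∀ {A : Set} {m n} (f : Fin m → A) (g : Fin n → A) i → append f g (m ↑ʳ i) ≡ g i
append-↑ʳ {m = zero}  f g i = ≡.refl
append-↑ʳ {m = suc m} f g i = append-↑ʳ (f ∘ suc) g i

append-all : ∀ {A : Set} (P : A → Set) {m n} (f : Fin m → A) (g : Fin n → A) →
             (∀ i → P (f i)) → (∀ i → P (g i)) → ∀ i → P (append f g i)
append-all P {m = zero}  f g Pf Pg i       = Pg i
append-all P {m = suc m} f g Pf Pg zero    = Pf zero
append-all P {m = suc m} f g Pf Pg (suc i) = append-all P (f ∘ suc) g (Pf ∘ suc) Pg i

↑-elim : ∀ m {n} (P : Fin (m ℕ.+ n) → Set) → (∀ i → P (i ↑ˡ n)) → (∀ i → P (m ↑ʳ i)) → ∀ i → P i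
↑-elim zero    P l r i       = r i
↑-elim (suc m) P l r zero    = l zero
↑-elim (suc m) P l r (suc i) = ↑-elim m (P ∘ suc) (l ∘ suc) r i

cons : ∀ {A : Set} {m} → A → (Fin m → A) → Fin (suc m) → A
cons x f zero    = x
cons x f (suc i) = f i

-- Pascal's rule as a definition, so that `Fin (binomial N r)` splits in the way `append` splits the
-- list of subsets; `binomial≡C` links it to `_C_`.
binomial : ℕ → ℕ → ℕ
binomial n       zero    = 1
binomial zero    (suc k) = 0
binomial (suc n) (suc k) = binomial n k ℕ.+ binomial n (suc k)

subset : ∀ N r → Fin (binomial N r) → Vec Bool N
subset N       zero    i = replicate N false
subset (suc N) (suc r) i = append (λ j → true ∷ subset N r j) (λ j → false ∷ subset N (suc r) j) i

-- Needed so that a form of degree r that vanishes at all listed subsets is zero; this is what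
-- bounds the rank of Λʳ from above.
subset-surjective : ∀ {N r} (S : Vec Bool N) → ∣ S ∣ ≡ r → ∃[ i ] subset N r i ≡ S
subset-surjective [] ≡.refl = zero , ≡.refl
subset-surjective {suc N} (true ∷ S) ≡.refl with subset-surjective S ≡.refl
... | i , eq = i ↑ˡ _ ,
  ≡.trans (append-↑ˡ (λ j → true ∷ subset N ∣ S ∣ j) (λ j → false ∷ subset N (suc ∣ S ∣) j) i) (≡.cong (true ∷_) eq)
subset-surjective {suc N} {zero} (false ∷ S) ∣S∣≡r with subset-surjective S ∣S∣≡r
... | i , eq = zero , ≡.cong (false ∷_) eq
subset-surjective {suc N} {suc r} (false ∷ S) ∣S∣≡r with subset-surjective S ∣S∣≡r
... | i , eq = binomial N r ↑ʳ i ,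
  ≡.trans (append-↑ʳ (λ j → true ∷ subset N r j) (λ j → false ∷ subset N (suc r) j) i) (≡.cong (false ∷_) eq)

-- Linear algebra over an integral domain

module Linear (D : Domain) where
  open Domain D public
  open IntegerSolver commutativeRing public
  open import Algebra.Properties.Semiring.Sum semiring public
    using (sum; sum-cong-≋; sum-replicate-zero; ∑-distrib-+; ∑-comm; *-distribˡ-sum; *-distribʳ-sum)
  open import Algebra.Properties.Ring ring public using (-0#≈0#; -‿involutive; -‿distribˡ-*; -‿distribʳ-*; -‿+-comm)
  open import Relation.Binary.Reasoning.Setoid setoid

  Vect : ℕ → Set
  Vect n = Fin n → Carrier

  sum-zero : ∀ {m} {f : Fin m → Carrier} → (∀ i → f i ≈ 0#) → sum f ≈ 0#
  sum-zero {m} f≈0 = trans (sum-cong-≋ f≈0) (sum-replicate-zero m)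

  sum-neg : ∀ {m} (f : Fin m → Carrier) → sum (λ i → - f i) ≈ - sum f
  sum-neg {zero}  f = sym -0#≈0#
  sum-neg {suc m} f = trans (+-congˡ (sum-neg (f ∘ suc))) (-‿+-comm _ _)

  sum-minus : ∀ {m} (f g : Fin m → Carrier) → sum (λ i → f i - g i) ≈ sum f - sum g
  sum-minus f g = trans (∑-distrib-+ f (λ i → - g i)) (+-congˡ (sum-neg g))

  sum-single : ∀ {m} (f : Fin m → Carrier) i → (∀ j → ¬ j ≡ i → f j ≈ 0#) → sum f ≈ f i
  sum-single f zero    f≈0 = trans (+-congˡ (sum-zero (λ j → f≈0 (suc j) λ ()))) (+-identityʳ _)
  sum-single f (suc i) f≈0 = trans (+-cong (f≈0 zero λ ())
    (sum-single (f ∘ suc) i λ j j≢i → f≈0 (suc j) λ { ≡.refl → j≢i ≡.refl })) (+-identityˡ _)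

  zero-* : ∀ {x} y → x ≈ 0# → x * y ≈ 0#
  zero-* y x≈0 = trans (*-congʳ x≈0) (zeroˡ y)

  *-zero : ∀ x {y} → y ≈ 0# → x * y ≈ 0#
  *-zero x y≈0 = trans (*-congˡ y≈0) (zeroʳ x)

  neg-zero : ∀ {x} → x ≈ 0# → - x ≈ 0#
  neg-zero x≈0 = trans (-‿cong x≈0) -0#≈0#

  zero-minus-zero : ∀ {x y} → x ≈ 0# → y ≈ 0# → x - y ≈ 0#
  zero-minus-zero x≈0 y≈0 = trans (+-cong x≈0 (neg-zero y≈0)) (+-identityˡ 0#)

  lin : ∀ {m n} → (Fin m → Carrier) → (Fin m → Vect n) → Vect n
  lin c X a = sum (λ i → c i * X i a)

  lin-cong : ∀ {m n} {c d : Fin m → Carrier} {X Y : Fin m → Vect n} →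
             (∀ i → c i ≈ d i) → (∀ i a → X i a ≈ Y i a) → ∀ a → lin c X a ≈ lin d Y a
  lin-cong c≈d X≈Y a = sum-cong-≋ (λ i → *-cong (c≈d i) (X≈Y i a))

  lin-zero : ∀ {m n} {c : Fin m → Carrier} (X : Fin m → Vect n) →
             (∀ i → c i ≈ 0#) → ∀ a → lin c X a ≈ 0#
  lin-zero X c≈0 a = sum-zero (λ i → zero-* _ (c≈0 i))

  lin-+ : ∀ {m n} (c d : Fin m → Carrier) (X : Fin m → Vect n) a →
          lin (λ i → c i + d i) X a ≈ lin c X a + lin d X a
  lin-+ c d X a = trans (sum-cong-≋ (λ i → distribʳ (X i a) (c i) (d i))) (∑-distrib-+ (λ i → c i * X i a) (λ i → d i * X i a))

  lin-scale : ∀ {m n} s (c : Fin m → Carrier) (X : Fin m → Vect n) a →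
              lin (λ i → s * c i) X a ≈ s * lin c X a
  lin-scale s c X a = trans (sum-cong-≋ (λ i → *-assoc s (c i) (X i a))) (sym (*-distribˡ-sum s (λ i → c i * X i a)))

  lin-neg : ∀ {m n} (c : Fin m → Carrier) (X : Fin m → Vect n) a →
            lin (λ i → - c i) X a ≈ - lin c X a
  lin-neg c X a = trans (sum-cong-≋ (λ i → sym (-‿distribˡ-* (c i) (X i a)))) (sum-neg (λ i → c i * X i a))

  lin-lin : ∀ {m p n} (c : Fin m → Carrier) (Γ : Fin m → Fin p → Carrier) (X : Fin p → Vect n) a →
            lin (lin c Γ) X a ≈ lin c (λ i → lin (Γ i) X) a
  lin-lin c Γ X a = begin
    sum (λ l → sum (λ i → c i * Γ i l) * X l a)      ≈⟨ sum-cong-≋ (λ l → *-distribʳ-sum (X l a) (λ i → c i * Γ i l)) ⟩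
    sum (λ l → sum (λ i → c i * Γ i l * X l a))      ≈⟨ ∑-comm (λ l i → c i * Γ i l * X l a) ⟩
    sum (λ i → sum (λ l → c i * Γ i l * X l a))      ≈⟨ sum-cong-≋ (λ i → lin-scale (c i) (Γ i) X a) ⟩
    sum (λ i → c i * sum (λ l → Γ i l * X l a))      ∎

  -- The map `f` allows families of another type: `lookup ∘ append X Y` is covered without moving
  -- `lookup` past `append`.
  lin-append : ∀ {A : Set} {m p n} (f : A → Vect n) (c : Fin (m ℕ.+ p) → Carrier) (X : Fin m → A) (Y : Fin p → A) a →
               lin c (f ∘ append X Y) a ≈ lin (c ∘ (_↑ˡ p)) (f ∘ X) a + lin (c ∘ (m ↑ʳ_)) (f ∘ Y) a
  lin-append {m = zero}  f c X Y a = sym (+-identityˡ _)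
  lin-append {m = suc m} f c X Y a = trans (+-congˡ (lin-append {m = m} f (c ∘ suc) (X ∘ suc) Y a)) (sym (+-assoc _ _ _))

  Indep : ∀ {m n} → (Fin m → Vect n) → Set
  Indep X = ∀ c → (∀ a → lin c X a ≈ 0#) → ∀ i → c i ≈ 0#

  Indep-tail : ∀ {m n} (X : Fin (suc m) → Vect n) → Indep X → Indep (X ∘ suc)
  Indep-tail X indep c eq i = indep (cons 0# c) (λ a → trans (+-cong (zeroˡ _) (eq a)) (+-identityˡ _)) (suc i)

  Indep-unique : ∀ {m n} {X : Fin m → Vect n} → Indep X → ∀ c d → (∀ a → lin c X a ≈ lin d X a) → ∀ i → c i ≈ d i
  Indep-unique {X = X} indep c d eq i = begin
    c i                  ≈⟨ solve 2 (λ x y → x := (x :- y) :+ y) refl (c i) (d i) ⟩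
    (c i - d i) + d i    ≈⟨ +-congʳ (indep (λ j → c j - d j) diff i) ⟩
    0# + d i             ≈⟨ +-identityˡ _ ⟩
    d i                  ∎
    where
    diff : ∀ a → lin (λ j → c j - d j) X a ≈ 0#
    diff a = begin
      lin (λ j → c j - d j) X a          ≈⟨ lin-+ c (λ j → - d j) X a ⟩
      lin c X a + lin (λ j → - d j) X a  ≈⟨ +-cong (eq a) (lin-neg d X a) ⟩
      lin d X a - lin d X a              ≈⟨ -‿inverseʳ _ ⟩
      0#                                 ∎

  Indep⇒head≉0 : ∀ {m n} (X : Fin (suc m) → Vect n) → Indep X → ¬ (∀ a → X zero a ≈ 0#)
  Indep⇒head≉0 X indep X₀≈0 = 1≉0 (indep (cons 1# (λ _ → 0#))
    (λ a → trans (+-cong (*-zero 1# (X₀≈0 a)) (lin-zero (X ∘ suc) (λ _ → refl) a)) (+-identityˡ 0#)) zero)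

  Indep-scale : ∀ {m n} {X : Fin m → Vect n} {s} → ¬ s ≈ 0# → Indep X → Indep (λ i a → s * X i a)
  Indep-scale {X = X} {s} s≉0 indep c eq i = *-cancel s≉0 (indep (λ i → s * c i)
    (λ a → trans (sum-cong-≋ (λ i → solve 3 (λ s c x → s :* c :* x := c :* (s :* x)) refl s (c i) (X i a))) (eq a)) i)

  _∈Span_ : ∀ {m n} → Vect n → (Fin m → Vect n) → Set
  v ∈Span X = ∃[ c ] (∀ a → v a ≈ lin c X a)

  -- Rank at least `d` for the intersection of the two spans, given by witnesses with coefficients
  -- in the ring, so that it can be carried along a change of ring.
  Meets : ∀ d {p q n} → (Fin p → Vect n) → (Fin q → Vect n) → Set
  Meets d {n = n} P Q = Σ (Fin d → Vect n) λ y → Indep y × (∀ l → y l ∈Span P) × (∀ l → y l ∈Span Q)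

  -- P and Q are bases of two spaces whose intersection is spanned by their
  -- common first s vectors.
  record Adapted {p n} (s : ℕ) (P Q : Fin p → Vect n) : Set where
    field
      shared : ∀ l → toℕ l < s → ∀ a → P l a ≈ Q l a
      joint  : ∀ c d → (∀ l → toℕ l < s → d l ≈ 0#) → (∀ a → lin c P a + lin d Q a ≈ 0#) →
               (∀ l → c l ≈ 0#) × (∀ l → d l ≈ 0#)

    Indepˡ : Indep P
    Indepˡ c eq = proj₁ (joint c (λ _ → 0#) (λ _ _ → refl)
      (λ a → trans (+-cong (eq a) (lin-zero Q (λ _ → refl) a)) (+-identityˡ 0#)))

  -- A shared head of `Q` is the head of the independent family `P`. If nothing is shared, `joint`
  -- puts no restriction on `d`, and `Q` is independent itself.
  Adapted⇒headʳ≉0 : ∀ {p n s} {P Q : Fin (suc p) → Vect n} → Adapted s P Q → ¬ (∀ a → Q zero a ≈ 0#)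
  Adapted⇒headʳ≉0 {s = suc s} {P} ad Q₀≈0 = Indep⇒head≉0 P (Adapted.Indepˡ ad)
    (λ a → trans (Adapted.shared ad zero (s≤s z≤n) a) (Q₀≈0 a))
  Adapted⇒headʳ≉0 {s = zero} {P} {Q} ad Q₀≈0 = Indep⇒head≉0 Q
    (λ d eq → proj₂ (Adapted.joint ad (λ _ → 0#) d (λ _ ())
      (λ a → trans (+-cong (lin-zero P (λ _ → refl) a) (eq a)) (+-identityˡ 0#)))) Q₀≈0

-- Exterior algebra and the bound in dimension 2r

module Exterior (D : Domain) where
  open Linear D
  open import Relation.Binary.Reasoning.Setoid setoid

  -- The exterior algebra of Rᴺ: a form is given by its coefficients on the
  -- basis e_S, where S ⊆ {0, …, N-1} is read as a bit vector.
  Λ : ℕ → Set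
  Λ N = Vec Bool N → Carrier

  -- Write v = v₀ e₀ + v′ and x = x_f + e₀ ∧ x_t; then
  -- v ∧ x = v′ ∧ x_f + e₀ ∧ (v₀ x_f - v′ ∧ x_t).
  wedge : ∀ {N} → Vect N → Λ N → Λ N
  wedge v x []          = 0#
  wedge v x (false ∷ S) = wedge (v ∘ suc) (x ∘ (false ∷_)) S
  wedge v x (true ∷ S)  = v zero * x (false ∷ S) - wedge (v ∘ suc) (x ∘ (true ∷_)) S

  -- Interior product with the coordinate functional `a`. The sign in the last clause comes from
  -- passing e₀.
  contract : ∀ {N} → Fin N → Λ N → Λ N
  contract zero    x (false ∷ S) = x (true ∷ S)
  contract zero    x (true ∷ S)  = 0#
  contract (suc a) x (false ∷ S) = contract a (x ∘ (false ∷_)) S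
  contract (suc a) x (true ∷ S)  = - contract a (x ∘ (true ∷_)) S

  one : ∀ {N} → Λ N
  one []          = 1#
  one (false ∷ S) = one S
  one (true ∷ S)  = 0#

  wedges : ∀ {m N} → (Fin m → Vect N) → Λ N → Λ N
  wedges {zero}  X x = x
  wedges {suc m} X x = wedge (X zero) (wedges (X ∘ suc) x)

  wedge-cong : ∀ {N} {u v : Vect N} {x y : Λ N} → (∀ a → u a ≈ v a) → (∀ S → x S ≈ y S) →
               ∀ S → wedge u x S ≈ wedge v y S
  wedge-cong u≈v x≈y []          = refl
  wedge-cong u≈v x≈y (false ∷ S) = wedge-cong (u≈v ∘ suc) (x≈y ∘ (false ∷_)) S
  wedge-cong u≈v x≈y (true ∷ S)  = +-cong (*-cong (u≈v zero) (x≈y (false ∷ S)))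
    (-‿cong (wedge-cong (u≈v ∘ suc) (x≈y ∘ (true ∷_)) S))

  wedge-sumʳ : ∀ {m N} (v : Vect N) (c : Fin m → Carrier) (x : Fin m → Λ N) S →
               wedge v (λ T → sum (λ i → c i * x i T)) S ≈ sum (λ i → c i * wedge v (x i) S)
  wedge-sumʳ v c x []          = sym (sum-zero (λ i → zeroʳ (c i)))
  wedge-sumʳ v c x (false ∷ S) = wedge-sumʳ (v ∘ suc) c (λ i → x i ∘ (false ∷_)) S
  wedge-sumʳ v c x (true ∷ S)  = begin
    v zero * sum (λ i → c i * x i (false ∷ S)) - wedge (v ∘ suc) (λ T → sum (λ i → c i * x i (true ∷ T))) S
      ≈⟨ +-cong (*-distribˡ-sum (v zero) (λ i → c i * x i (false ∷ S))) (-‿cong (wedge-sumʳ (v ∘ suc) c (λ i → x i ∘ (true ∷_)) S)) ⟩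
    sum (λ i → v zero * (c i * x i (false ∷ S))) - sum (λ i → c i * w i)
      ≈⟨ sum-minus (λ i → v zero * (c i * x i (false ∷ S))) (λ i → c i * w i) ⟨
    sum (λ i → v zero * (c i * x i (false ∷ S)) - c i * w i)
      ≈⟨ sum-cong-≋ (λ i → solve 4 (λ a b d e → a :* (b :* d) :- b :* e := b :* (a :* d :- e)) refl
           (v zero) (c i) (x i (false ∷ S)) (w i)) ⟩
    sum (λ i → c i * (v zero * x i (false ∷ S) - w i)) ∎
    where
    w : Fin _ → Carrier
    w i = wedge (v ∘ suc) (x i ∘ (true ∷_)) S

  wedge-sumˡ : ∀ {m N} (c : Fin m → Carrier) (X : Fin m → Vect N) (x : Λ N) S →
               wedge (lin c X) x S ≈ sum (λ i → c i * wedge (X i) x S)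
  wedge-sumˡ c X x []          = sym (sum-zero (λ i → zeroʳ (c i)))
  wedge-sumˡ c X x (false ∷ S) = wedge-sumˡ c (λ i → X i ∘ suc) (x ∘ (false ∷_)) S
  wedge-sumˡ c X x (true ∷ S)  = begin
    lin c X zero * x (false ∷ S) - wedge (lin c (λ i → X i ∘ suc)) (x ∘ (true ∷_)) S
      ≈⟨ +-cong (*-distribʳ-sum (x (false ∷ S)) (λ i → c i * X i zero)) (-‿cong (wedge-sumˡ c (λ i → X i ∘ suc) (x ∘ (true ∷_)) S)) ⟩
    sum (λ i → c i * X i zero * x (false ∷ S)) - sum (λ i → c i * w i)
      ≈⟨ sum-minus (λ i → c i * X i zero * x (false ∷ S)) (λ i → c i * w i) ⟨
    sum (λ i → c i * X i zero * x (false ∷ S) - c i * w i)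
      ≈⟨ sum-cong-≋ (λ i → solve 4 (λ a b d e → b :* a :* d :- b :* e := b :* (a :* d :- e)) refl
           (X i zero) (c i) (x (false ∷ S)) (w i)) ⟩
    sum (λ i → c i * (X i zero * x (false ∷ S) - w i)) ∎
    where
    w : Fin _ → Carrier
    w i = wedge (X i ∘ suc) (x ∘ (true ∷_)) S

  -- The e₀-component of a wedge has the shape s x - y with s = v₀, so this is the form of linearity
  -- that arises when two wedges are nested.
  wedge-axpy : ∀ {N} (v : Vect N) s (x y : Λ N) S →
               wedge v (λ T → s * x T - y T) S ≈ s * wedge v x S - wedge v y S
  wedge-axpy v s x y []          = solve 1 (λ s → :0 := s :* :0 :- :0) refl s
  wedge-axpy v s x y (false ∷ S) = wedge-axpy (v ∘ suc) s (x ∘ (false ∷_)) (y ∘ (false ∷_)) S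
  wedge-axpy v s x y (true ∷ S)  = begin
    v zero * (s * x (false ∷ S) - y (false ∷ S)) - wedge (v ∘ suc) (λ T → s * x (true ∷ T) - y (true ∷ T)) S
      ≈⟨ +-congˡ (-‿cong (wedge-axpy (v ∘ suc) s (x ∘ (true ∷_)) (y ∘ (true ∷_)) S)) ⟩
    v zero * (s * x (false ∷ S) - y (false ∷ S)) - (s * wedge (v ∘ suc) (x ∘ (true ∷_)) S - wedge (v ∘ suc) (y ∘ (true ∷_)) S)
      ≈⟨ solve 6 (λ v s x y p q → v :* (s :* x :- y) :- (s :* p :- q) := s :* (v :* x :- p) :- (v :* y :- q)) refl
           (v zero) s (x (false ∷ S)) (y (false ∷ S)) (wedge (v ∘ suc) (x ∘ (true ∷_)) S) (wedge (v ∘ suc) (y ∘ (true ∷_)) S) ⟩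
    s * wedge v x (true ∷ S) - wedge v y (true ∷ S) ∎

  wedge-zero : ∀ {N} (v : Vect N) {x : Λ N} → (∀ S → x S ≈ 0#) → ∀ S → wedge v x S ≈ 0#
  wedge-zero v x≈0 []          = refl
  wedge-zero v x≈0 (false ∷ S) = wedge-zero (v ∘ suc) (x≈0 ∘ (false ∷_)) S
  wedge-zero v x≈0 (true ∷ S)  = zero-minus-zero (*-zero _ (x≈0 _)) (wedge-zero (v ∘ suc) (x≈0 ∘ (true ∷_)) S)

  wedges-zero : ∀ {m N} (X : Fin m → Vect N) {x : Λ N} → (∀ S → x S ≈ 0#) → ∀ S → wedges X x S ≈ 0#
  wedges-zero {zero}  X x≈0 = x≈0
  wedges-zero {suc m} X x≈0 = wedge-zero (X zero) (wedges-zero (X ∘ suc) x≈0)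

  wedge-neg : ∀ {N} (v : Vect N) (x : Λ N) S → wedge v (λ T → - x T) S ≈ - wedge v x S
  wedge-neg v x S = begin
    wedge v (λ T → - x T) S             ≈⟨ wedge-cong (λ _ → refl) (λ T → solve 1 (λ x → :- x := :0 :* x :- x) refl (x T)) S ⟩
    wedge v (λ T → 0# * x T - x T) S    ≈⟨ wedge-axpy v 0# x x S ⟩
    0# * wedge v x S - wedge v x S      ≈⟨ solve 1 (λ x → :0 :* x :- x := :- x) refl (wedge v x S) ⟩
    - wedge v x S                       ∎

  wedge-anticomm : ∀ {N} (u v : Vect N) (x : Λ N) S → wedge u (wedge v x) S ≈ - wedge v (wedge u x) S
  wedge-anticomm u v x []          = sym -0#≈0#
  wedge-anticomm u v x (false ∷ S) = wedge-anticomm (u ∘ suc) (v ∘ suc) (x ∘ (false ∷_)) S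
  wedge-anticomm u v x (true ∷ S)  = begin
    u zero * wedge v′ xf S - wedge u′ (λ T → v zero * xf T - wedge v′ xt T) S
      ≈⟨ +-congˡ (-‿cong (wedge-axpy u′ (v zero) xf (wedge v′ xt) S)) ⟩
    u zero * wedge v′ xf S - (v zero * wedge u′ xf S - wedge u′ (wedge v′ xt) S)
      ≈⟨ +-congˡ (-‿cong (+-congˡ (-‿cong (wedge-anticomm u′ v′ xt S)))) ⟩
    u zero * wedge v′ xf S - (v zero * wedge u′ xf S - - wedge v′ (wedge u′ xt) S)
      ≈⟨ solve 5 (λ a b c d e → a :* b :- (c :* d :- :- e) := :- (c :* d :- (a :* b :- e))) refl
           (u zero) (wedge v′ xf S) (v zero) (wedge u′ xf S) (wedge v′ (wedge u′ xt) S) ⟩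
    - (v zero * wedge u′ xf S - (u zero * wedge v′ xf S - wedge v′ (wedge u′ xt) S))
      ≈⟨ -‿cong (+-congˡ (-‿cong (wedge-axpy v′ (u zero) xf (wedge u′ xt) S))) ⟨
    - (v zero * wedge u′ xf S - wedge v′ (λ T → u zero * xf T - wedge u′ xt T) S) ∎
    where
    u′ = u ∘ suc
    v′ = v ∘ suc
    xf = x ∘ (false ∷_)
    xt = x ∘ (true ∷_)

  -- Proved by its own induction, because in characteristic 2 anticommutativity does not imply it.
  wedge-self : ∀ {N} (v : Vect N) (x : Λ N) S → wedge v (wedge v x) S ≈ 0#
  wedge-self v x []          = refl
  wedge-self v x (false ∷ S) = wedge-self (v ∘ suc) (x ∘ (false ∷_)) S
  wedge-self v x (true ∷ S)  = begin
    v zero * wedge v′ xf S - wedge v′ (λ T → v zero * xf T - wedge v′ xt T) S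
      ≈⟨ +-congˡ (-‿cong (wedge-axpy v′ (v zero) xf (wedge v′ xt) S)) ⟩
    v zero * wedge v′ xf S - (v zero * wedge v′ xf S - wedge v′ (wedge v′ xt) S)
      ≈⟨ solve 2 (λ a b → a :- (a :- b) := b) refl (v zero * wedge v′ xf S) (wedge v′ (wedge v′ xt) S) ⟩
    wedge v′ (wedge v′ xt) S
      ≈⟨ wedge-self v′ xt S ⟩
    0# ∎
    where
    v′ = v ∘ suc
    xf = x ∘ (false ∷_)
    xt = x ∘ (true ∷_)

  contract-zero : ∀ {N} (a : Fin N) {x : Λ N} → (∀ S → x S ≈ 0#) → ∀ S → contract a x S ≈ 0#
  contract-zero zero    x≈0 (false ∷ S) = x≈0 (true ∷ S)
  contract-zero zero    x≈0 (true ∷ S)  = refl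
  contract-zero (suc a) x≈0 (false ∷ S) = contract-zero a (x≈0 ∘ (false ∷_)) S
  contract-zero (suc a) x≈0 (true ∷ S)  = neg-zero (contract-zero a (x≈0 ∘ (true ∷_)) S)

  contract-axpy : ∀ {N} (a : Fin N) s (x y : Λ N) S →
                  contract a (λ T → s * x T - y T) S ≈ s * contract a x S - contract a y S
  contract-axpy zero    s x y (false ∷ S) = refl
  contract-axpy zero    s x y (true ∷ S)  = solve 1 (λ s → :0 := s :* :0 :- :0) refl s
  contract-axpy (suc a) s x y (false ∷ S) = contract-axpy a s (x ∘ (false ∷_)) (y ∘ (false ∷_)) S
  contract-axpy (suc a) s x y (true ∷ S)  = trans (-‿cong (contract-axpy a s (x ∘ (true ∷_)) (y ∘ (true ∷_)) S))
    (solve 3 (λ s p q → :- (s :* p :- q) := s :* :- p :- :- q) refl s (contract a (x ∘ (true ∷_)) S) (contract a (y ∘ (true ∷_)) S))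

  contract-one : ∀ {N} (a : Fin N) S → contract a one S ≈ 0#
  contract-one zero    (false ∷ S) = refl
  contract-one zero    (true ∷ S)  = refl
  contract-one (suc a) (false ∷ S) = contract-one a S
  contract-one (suc a) (true ∷ S)  = neg-zero (contract-zero a (λ _ → refl) S)

  contract-wedge : ∀ {N} (a : Fin N) (v : Vect N) (x : Λ N) S →
                   contract a (wedge v x) S ≈ v a * x S - wedge v (contract a x) S
  contract-wedge zero    v x (false ∷ S) = refl
  contract-wedge zero    v x (true ∷ S)  = begin
    0#
      ≈⟨ solve 2 (λ a b → :0 := a :* b :- (a :* b :- :0)) refl (v zero) (x (true ∷ S)) ⟩
    v zero * x (true ∷ S) - (v zero * x (true ∷ S) - 0#)
      ≈⟨ +-congˡ (-‿cong (+-congˡ (-‿cong (wedge-zero (v ∘ suc) (λ _ → refl) S)))) ⟨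
    v zero * x (true ∷ S) - wedge v (contract zero x) (true ∷ S) ∎
  contract-wedge (suc a) v x (false ∷ S) = contract-wedge a (v ∘ suc) (x ∘ (false ∷_)) S
  contract-wedge (suc a) v x (true ∷ S)  = begin
    - contract a (λ T → v zero * xf T - wedge v′ xt T) S
      ≈⟨ -‿cong (contract-axpy a (v zero) xf (wedge v′ xt) S) ⟩
    - (v zero * contract a xf S - contract a (wedge v′ xt) S)
      ≈⟨ -‿cong (+-congˡ (-‿cong (contract-wedge a v′ xt S))) ⟩
    - (v zero * contract a xf S - (v′ a * xt S - wedge v′ (contract a xt) S))
      ≈⟨ solve 3 (λ p q r → :- (p :- (q :- r)) := q :- (p :- :- r)) refl (v zero * contract a xf S) (v′ a * xt S) (wedge v′ (contract a xt) S) ⟩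
    v′ a * xt S - (v zero * contract a xf S - - wedge v′ (contract a xt) S)
      ≈⟨ +-congˡ (-‿cong (+-congˡ (-‿cong (wedge-neg v′ (contract a xt) S)))) ⟨
    v′ a * xt S - (v zero * contract a xf S - wedge v′ (λ T → - contract a xt T) S) ∎
    where
    v′ = v ∘ suc
    xf = x ∘ (false ∷_)
    xt = x ∘ (true ∷_)

  -- (-1)ʲ times the product of all `X i` with i ≠ j: the cofactors in the Laplace expansion
  -- `contract-wedges`.
  minors : ∀ {m N} → (Fin (suc m) → Vect N) → Fin (suc m) → Λ N
  minors X zero = wedges (X ∘ suc) one
  minors {suc m} X (suc j) S = - wedge (X zero) (minors (X ∘ suc) j) S

  contract-wedges : ∀ {m N} (X : Fin (suc m) → Vect N) a S →
                    contract a (wedges X one) S ≈ sum (λ j → X j a * minors X j S)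
  contract-wedges {zero}  X a S = trans (contract-wedge a (X zero) one S)
    (+-congˡ (neg-zero (wedge-zero (X zero) (contract-one a) S)))
  contract-wedges {suc m} X a S = trans (contract-wedge a (X zero) (wedges X′ one) S) (+-congˡ (begin
    - wedge (X zero) (contract a (wedges X′ one)) S
      ≈⟨ -‿cong (wedge-cong (λ _ → refl) (contract-wedges X′ a) S) ⟩
    - wedge (X zero) (λ T → sum (λ j → X′ j a * minors X′ j T)) S
      ≈⟨ -‿cong (wedge-sumʳ (X zero) (λ j → X′ j a) (minors X′) S) ⟩
    - sum (λ j → X′ j a * wedge (X zero) (minors X′ j) S)
      ≈⟨ sum-neg (λ j → X′ j a * wedge (X zero) (minors X′ j) S) ⟨
    sum (λ j → - (X′ j a * wedge (X zero) (minors X′ j) S))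
      ≈⟨ sum-cong-≋ (λ j → -‿distribʳ-* (X′ j a) (wedge (X zero) (minors X′ j) S)) ⟩
    sum (λ j → X′ j a * - wedge (X zero) (minors X′ j) S) ∎))
    where X′ = X ∘ suc

  one-empty : ∀ {N} → one (replicate N false) ≈ 1#
  one-empty {zero}  = refl
  one-empty {suc N} = one-empty {N}

  -- Contracting a vanishing product yields a linear relation whose leading
  -- coefficients are the coordinates of the product of the remaining vectors.
  Indep⇒wedges≉0 : ∀ {m N} (X : Fin m → Vect N) → Indep X → ¬ (∀ S → wedges X one S ≈ 0#)
  Indep⇒wedges≉0 {zero}  {N} X indep vanish = 1≉0 (trans (sym (one-empty {N})) (vanish (replicate N false)))
  Indep⇒wedges≉0 {suc m} X indep vanish =
    Indep⇒wedges≉0 (X ∘ suc) (Indep-tail X indep) λ S →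
      indep (λ j → minors X j S)
        (λ a → trans (sum-cong-≋ (λ j → *-comm (minors X j S) (X j a)))
               (trans (sym (contract-wedges X a S)) (contract-zero a vanish S))) zero

  -- The recursion strips bits from the front of `S`; `d` counts the stripped elements, so that
  -- homogeneity can be restated for the remaining form.
  wedge-degree : ∀ {N} d {m} (v : Vect N) (x : Λ N) →
                 (∀ S → ¬ d ℕ.+ ∣ S ∣ ≡ m → x S ≈ 0#) →
                 ∀ S → ¬ d ℕ.+ ∣ S ∣ ≡ suc m → wedge v x S ≈ 0#
  wedge-degree d v x hom []          ne = refl
  wedge-degree d v x hom (false ∷ S) ne = wedge-degree d (v ∘ suc) (x ∘ (false ∷_)) (hom ∘ (false ∷_)) S ne
  wedge-degree d {m} v x hom (true ∷ S) ne = zero-minus-zero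
    (*-zero _ (hom (false ∷ S) (λ e → ne (≡.trans (ℕ.+-suc d ∣ S ∣) (≡.cong suc e)))))
    (wedge-degree (suc d) (v ∘ suc) (x ∘ (true ∷_))
      (λ T ne′ → hom (true ∷ T) (λ e → ne′ (≡.trans (≡.sym (ℕ.+-suc d ∣ T ∣)) e))) S
      (λ e → ne (≡.trans (ℕ.+-suc d ∣ S ∣) e)))

  wedges-degree : ∀ {m N} (X : Fin m → Vect N) S → ¬ ∣ S ∣ ≡ m → wedges X one S ≈ 0#
  wedges-degree {zero}  X S ne = one-degree S ne
    where
    one-degree : ∀ {N} (S : Vec Bool N) → ¬ ∣ S ∣ ≡ 0 → one S ≈ 0#
    one-degree []          ne = contradiction ≡.refl ne
    one-degree (false ∷ S) ne = one-degree S ne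
    one-degree (true ∷ S)  ne = refl
  wedges-degree {suc m} X S ne = wedge-degree 0 (X zero) (wedges (X ∘ suc) one) (wedges-degree (X ∘ suc)) S ne

  -- A product of m vectors lives on subsets of size m, and there are none when m > N. This replaces
  -- elimination in every dimension count below.
  many⇒¬Indep : ∀ {m N} (X : Fin m → Vect N) → N < m → ¬ Indep X
  many⇒¬Indep X N<m indep = Indep⇒wedges≉0 X indep λ S →
    wedges-degree X S λ eq → ℕ.<⇒≱ N<m (≡.subst (_≤ _) eq (∣p∣≤n S))

  sign : ℕ → Carrier
  sign zero    = 1#
  sign (suc m) = - sign m

  wedge-wedges : ∀ {m N} (u : Vect N) (X : Fin m → Vect N) (x : Λ N) S →
                 wedge u (wedges X x) S ≈ sign m * wedges X (wedge u x) S
  wedge-wedges {zero}  u X x S = sym (*-identityˡ _)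
  wedge-wedges {suc m} u X x S = begin
    wedge u (wedge (X zero) y) S
      ≈⟨ wedge-anticomm u (X zero) y S ⟩
    - wedge (X zero) (wedge u y) S
      ≈⟨ -‿cong (wedge-cong (λ _ → refl) (wedge-wedges u (X ∘ suc) x) S) ⟩
    - wedge (X zero) (λ T → sign m * z T) S
      ≈⟨ -‿cong (wedge-cong (λ _ → refl) (λ T → solve 2 (λ s z → s :* z := s :* z :- :0) refl (sign m) (z T)) S) ⟩
    - wedge (X zero) (λ T → sign m * z T - 0#) S
      ≈⟨ -‿cong (wedge-axpy (X zero) (sign m) z (λ _ → 0#) S) ⟩
    - (sign m * wedge (X zero) z S - wedge (X zero) (λ _ → 0#) S)
      ≈⟨ -‿cong (+-congˡ (neg-zero (wedge-zero (X zero) (λ _ → refl) S))) ⟩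
    - (sign m * wedge (X zero) z S + 0#)
      ≈⟨ solve 2 (λ s z → :- (s :* z :+ :0) := :- s :* z) refl (sign m) (wedge (X zero) z S) ⟩
    - sign m * wedge (X zero) z S ∎
    where
    y = wedges (X ∘ suc) x
    z = wedges (X ∘ suc) (wedge u x)

  wedge-member : ∀ {m N} (X : Fin m → Vect N) (x : Λ N) i S → wedge (X i) (wedges X x) S ≈ 0#
  wedge-member X x zero    S = wedge-self (X zero) (wedges (X ∘ suc) x) S
  wedge-member X x (suc i) S = trans (wedge-anticomm (X (suc i)) (X zero) (wedges (X ∘ suc) x) S)
    (neg-zero (wedge-zero (X zero) (wedge-member (X ∘ suc) x i) S))

  wedge-lin-member : ∀ {m N} (c : Fin m → Carrier) (X : Fin m → Vect N) (x : Λ N) S →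
                     wedge (lin c X) (wedges X x) S ≈ 0#
  wedge-lin-member c X x S = trans (wedge-sumˡ c X (wedges X x) S) (sum-zero (λ i → *-zero _ (wedge-member X x i S)))

  wedge-+ˡ : ∀ {N} (u v : Vect N) (x : Λ N) S → wedge (λ a → u a + v a) x S ≈ wedge u x S + wedge v x S
  wedge-+ˡ u v x []          = sym (+-identityˡ 0#)
  wedge-+ˡ u v x (false ∷ S) = wedge-+ˡ (u ∘ suc) (v ∘ suc) (x ∘ (false ∷_)) S
  wedge-+ˡ u v x (true ∷ S)  = trans (+-congˡ (-‿cong (wedge-+ˡ (u ∘ suc) (v ∘ suc) (x ∘ (true ∷_)) S)))
    (solve 5 (λ a b c d e → (a :+ b) :* c :- (d :+ e) := (a :* c :- d) :+ (b :* c :- e)) refl _ _ _ _ _)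

  wedge-scaleˡ : ∀ {N} s (v : Vect N) (x : Λ N) S → wedge (λ a → s * v a) x S ≈ s * wedge v x S
  wedge-scaleˡ s v x []          = sym (zeroʳ s)
  wedge-scaleˡ s v x (false ∷ S) = wedge-scaleˡ s (v ∘ suc) (x ∘ (false ∷_)) S
  wedge-scaleˡ s v x (true ∷ S)  = trans (+-congˡ (-‿cong (wedge-scaleˡ s (v ∘ suc) (x ∘ (true ∷_)) S)))
    (solve 4 (λ s a c d → s :* a :* c :- s :* d := s :* (a :* c :- d)) refl _ _ _ _)

  -- In the manner of Cramer's rule: multiplying the product by `c i` amounts to putting u =
  -- `lin c X` in place of `X i`, and u, once moved inwards, meets `x` with u ∧ x = 0. The recursion
  -- absorbs `X zero` into `x`.
  relation⇒wedges≈0 : ∀ {m N} (c : Fin m → Carrier) (X : Fin m → Vect N) (x : Λ N) →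
                      (∀ S → wedge (lin c X) x S ≈ 0#) → ∀ i S → c i * wedges X x S ≈ 0#
  relation⇒wedges≈0 {suc m} c X x rel i S = go i
    where
    X′ = X ∘ suc
    u′ = lin (c ∘ suc) X′

    split : ∀ y T → wedge (lin c X) y T ≈ c zero * wedge (X zero) y T + wedge u′ y T
    split y T = trans (wedge-+ˡ (λ a → c zero * X zero a) u′ y T) (+-congʳ (wedge-scaleˡ (c zero) (X zero) y T))

    -- The hypothesis for the tail, with X₀ ∧ x in place of `x`: the summand of u along X₀ dies
    -- against X₀.
    rel′ : ∀ T → wedge u′ (wedge (X zero) x) T ≈ 0#
    rel′ T = begin
      wedge u′ (wedge (X zero) x) T
        ≈⟨ +-identityˡ _ ⟨
      0# + wedge u′ (wedge (X zero) x) T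
        ≈⟨ +-congʳ (*-zero (c zero) (wedge-self (X zero) x T)) ⟨
      c zero * wedge (X zero) (wedge (X zero) x) T + wedge u′ (wedge (X zero) x) T
        ≈⟨ split (wedge (X zero) x) T ⟨
      wedge (lin c X) (wedge (X zero) x) T
        ≈⟨ wedge-anticomm (lin c X) (X zero) x T ⟩
      - wedge (X zero) (wedge (lin c X) x) T
        ≈⟨ neg-zero (wedge-zero (X zero) rel T) ⟩
      0# ∎

    go : ∀ i → c i * wedges X x S ≈ 0#
    -- Here c₀ X₀ may be replaced by u, because the rest of u lies in the span of the other factors.
    go zero = begin
      c zero * wedge (X zero) (wedges X′ x) S
        ≈⟨ +-identityʳ _ ⟨
      c zero * wedge (X zero) (wedges X′ x) S + 0#
        ≈⟨ +-congˡ (wedge-lin-member (c ∘ suc) X′ x S) ⟨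
      c zero * wedge (X zero) (wedges X′ x) S + wedge u′ (wedges X′ x) S
        ≈⟨ split (wedges X′ x) S ⟨
      wedge (lin c X) (wedges X′ x) S
        ≈⟨ wedge-wedges (lin c X) X′ x S ⟩
      sign m * wedges X′ (wedge (lin c X) x) S
        ≈⟨ *-zero _ (wedges-zero X′ rel S) ⟩
      0# ∎
    -- X₀ is moved inwards, at the cost of a sign, to reach the form required by the recursion.
    go (suc i) = begin
      c (suc i) * wedge (X zero) (wedges X′ x) S
        ≈⟨ *-congˡ (wedge-wedges (X zero) X′ x S) ⟩
      c (suc i) * (sign m * wedges X′ (wedge (X zero) x) S)
        ≈⟨ solve 3 (λ a b d → a :* (b :* d) := b :* (a :* d)) refl (c (suc i)) (sign m) _ ⟩
      sign m * (c (suc i) * wedges X′ (wedge (X zero) x) S)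
        ≈⟨ *-zero _ (relation⇒wedges≈0 (c ∘ suc) X′ (wedge (X zero) x) rel′ i S) ⟩
      0# ∎

  wedges-sumʳ : ∀ {p m N} (X : Fin p → Vect N) (c : Fin m → Carrier) (x : Fin m → Λ N) S →
                wedges X (λ T → sum (λ i → c i * x i T)) S ≈ sum (λ i → c i * wedges X (x i) S)
  wedges-sumʳ {zero}  X c x S = refl
  wedges-sumʳ {suc p} X c x S = trans (wedge-cong (λ _ → refl) (wedges-sumʳ (X ∘ suc) c x) S)
    (wedge-sumʳ (X zero) c (λ i → wedges (X ∘ suc) (x i)) S)

  wedges-split : ∀ m {p N} (X : Fin (m ℕ.+ p) → Vect N) (x : Λ N) →
                 wedges X x ≡ wedges (X ∘ (_↑ˡ p)) (wedges (X ∘ (m ↑ʳ_)) x)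
  wedges-split zero    X x = ≡.refl
  wedges-split (suc m) X x = ≡.cong (wedge (X zero)) (wedges-split m (X ∘ suc) x)

  -- Basis vectors of uᵢ and vᵢ form the two halves of one family. Trivial intersection on the
  -- diagonal is then just `Indep (X i)`, while off the diagonal the first half of one family meets
  -- the second half of another.
  Crossing : ∀ r {n} → (Fin (r ℕ.+ r) → Vect n) → (Fin (r ℕ.+ r) → Vect n) → Set
  Crossing r X Y = ∃[ c ] ∃[ d ] (∀ a → lin c (X ∘ (_↑ˡ r)) a ≈ lin d (Y ∘ (r ↑ʳ_)) a) × ¬ (∀ i → c i ≈ 0#)

  skew-bound-exact : ∀ {m} r (X : Fin m → Fin (r ℕ.+ r) → Vect (r ℕ.+ r)) → (∀ i → Indep (X i)) →
                     (∀ i j → i Fin.< j → Crossing r (X i) (X j)) → m ≤ binomial (r ℕ.+ r) r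
  skew-bound-exact {m} r X indep cross = ℕ.≮⇒≥ λ lt → many⇒¬Indep β lt β-indep
    where
    P Q : Fin m → Fin r → Vect (r ℕ.+ r)
    P i = X i ∘ (_↑ˡ r)
    Q i = X i ∘ (r ↑ʳ_)

    ω : Fin m → Λ (r ℕ.+ r)
    ω j = wedges (Q j) one

    β : Fin m → Vect (binomial (r ℕ.+ r) r)
    β j s = ω j (subset (r ℕ.+ r) r s)

    above : ∀ i j → i Fin.< j → ∀ S → wedges (P i) (ω j) S ≈ 0#
    above i j i<j S with cross i j i<j
    -- The common vector lies in the span of `Q j`, so it kills `ω j`. A nonzero coordinate of the
    -- product could then be cancelled, making every coefficient in `c` zero.
    ... | c , d , eq , c≉0 = ≈-stable λ ne → c≉0 λ l → *-cancel ne (trans (*-comm _ _)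
      (relation⇒wedges≈0 c (P i) (ω j)
        (λ T → trans (wedge-cong {u = lin c (P i)} eq (λ _ → refl) T) (wedge-lin-member d (Q j) one T)) l S))

    diagonal : ∀ i → ¬ (∀ S → wedges (P i) (ω i) S ≈ 0#)
    diagonal i vanish = Indep⇒wedges≉0 (X i) (indep i) λ S →
      trans (reflexive (≡.cong (λ f → f S) (wedges-split r (X i) one))) (vanish S)

    β-indep : Indep β
    β-indep c eq i = go i (<-wellFounded i)
      where
      -- `β` records only the coordinates of degree r. All others vanish, so a relation between the
      -- `β j` is one in the whole exterior algebra.
      ω-relation : ∀ S → sum (λ j → c j * ω j S) ≈ 0#
      ω-relation S with ∣ S ∣ ℕ.≟ r
      ... | no ne = sum-zero (λ j → *-zero (c j) (wedges-degree (Q j) S ne))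
      ... | yes ∣S∣≡r with subset-surjective S ∣S∣≡r
      ...   | s , s≡S = ≡.subst (λ T → sum (λ j → c j * ω j T) ≈ 0#) s≡S (eq s)

      -- Multiplying the relation by ⋀uᵢ kills the terms j > i by skewness; the terms j < i are gone
      -- by induction, and only the diagonal term is left.
      go : ∀ i → Acc Fin._<_ i → c i ≈ 0#
      go i (acc rs) = ≈-stable λ ci≉0 → diagonal i λ S → *-cancel ci≉0 (begin
        c i * wedges (P i) (ω i) S
          ≈⟨ sum-single (λ j → c j * wedges (P i) (ω j) S) i (off S) ⟨
        sum (λ j → c j * wedges (P i) (ω j) S)
          ≈⟨ wedges-sumʳ (P i) c ω S ⟨
        wedges (P i) (λ T → sum (λ j → c j * ω j T)) S
          ≈⟨ wedges-zero (P i) ω-relation S ⟩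
        0# ∎)
        where
        off : ∀ S j → ¬ j ≡ i → c j * wedges (P i) (ω j) S ≈ 0#
        off S j j≢i with Fin.<-cmp j i
        ... | tri< j<i _ _ = zero-* _ (go j (rs j<i))
        ... | tri≈ _ j≡i _ = contradiction j≡i j≢i
        ... | tri> _ _ i<j = *-zero _ (above i j i<j S)

-- Generic position over power series

module PowerSeries (D : Domain) where
  open Linear D
  open import Relation.Binary.Reasoning.Setoid setoid

  Series : Set
  Series = ℕ → Carrier

  _≋_ : Series → Series → Set
  f ≋ g = ∀ n → f n ≈ g n

  conv : Series → Series → Series
  conv f g zero    = f 0 * g 0
  conv f g (suc n) = f 0 * g (suc n) + conv (f ∘ suc) g n

  constant : Carrier → Series
  constant x zero    = x
  constant x (suc n) = 0#

  conv-cong : ∀ {f f′ g g′} → f ≋ f′ → g ≋ g′ → conv f g ≋ conv f′ g′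
  conv-cong f≋ g≋ zero    = *-cong (f≋ 0) (g≋ 0)
  conv-cong f≋ g≋ (suc n) = +-cong (*-cong (f≋ 0) (g≋ (suc n))) (conv-cong (f≋ ∘ suc) g≋ n)

  conv-zeroˡ : ∀ {f} g → (∀ n → f n ≈ 0#) → ∀ n → conv f g n ≈ 0#
  conv-zeroˡ g f≈0 zero    = zero-* _ (f≈0 0)
  conv-zeroˡ g f≈0 (suc n) = trans (+-cong (zero-* _ (f≈0 0)) (conv-zeroˡ g (f≈0 ∘ suc) n)) (+-identityˡ _)

  conv-constantˡ : ∀ x g n → conv (constant x) g n ≈ x * g n
  conv-constantˡ x g zero    = refl
  conv-constantˡ x g (suc n) = trans (+-congˡ (conv-zeroˡ g (λ _ → refl) n)) (+-identityʳ _)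

  -- `conv` consumes its left factor; this is the mirrored recursion, on which commutativity rests.
  conv-sucʳ : ∀ f g n → conv f g (suc n) ≈ conv f (g ∘ suc) n + f (suc n) * g 0
  conv-sucʳ f g zero    = refl
  conv-sucʳ f g (suc n) = trans (+-congˡ (conv-sucʳ (f ∘ suc) g n)) (sym (+-assoc _ _ _))

  conv-comm : ∀ f g → conv f g ≋ conv g f
  conv-comm f g zero    = *-comm _ _
  conv-comm f g (suc n) = begin
    f 0 * g (suc n) + conv (f ∘ suc) g n   ≈⟨ +-cong (*-comm _ _) (conv-comm (f ∘ suc) g n) ⟩
    g (suc n) * f 0 + conv g (f ∘ suc) n   ≈⟨ +-comm _ _ ⟩
    conv g (f ∘ suc) n + g (suc n) * f 0   ≈⟨ conv-sucʳ g f n ⟨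
    conv g f (suc n)                       ∎

  conv-distribʳ : ∀ h f g n → conv (λ i → f i + g i) h n ≈ conv f h n + conv g h n
  conv-distribʳ h f g zero    = distribʳ _ _ _
  conv-distribʳ h f g (suc n) = trans (+-congˡ (conv-distribʳ h (f ∘ suc) (g ∘ suc) n))
    (solve 5 (λ a b c d e → (a :+ b) :* c :+ (d :+ e) := (a :* c :+ d) :+ (b :* c :+ e)) refl (f 0) (g 0) (h (suc n)) _ _)

  conv-scaleˡ : ∀ s f g n → conv (λ i → s * f i) g n ≈ s * conv f g n
  conv-scaleˡ s f g zero    = *-assoc _ _ _
  conv-scaleˡ s f g (suc n) = trans (+-congˡ (conv-scaleˡ s (f ∘ suc) g n))
    (solve 4 (λ s a b c → s :* a :* b :+ s :* c := s :* (a :* b :+ c)) refl s (f 0) (g (suc n)) _)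

  conv-assoc : ∀ f g h → conv (conv f g) h ≋ conv f (conv g h)
  conv-assoc f g h zero    = *-assoc _ _ _
  conv-assoc f g h (suc n) = begin
    f 0 * g 0 * h (suc n) + conv (λ i → f 0 * g (suc i) + conv (f ∘ suc) g i) h n
      ≈⟨ +-congˡ (conv-distribʳ h (λ i → f 0 * g (suc i)) (conv (f ∘ suc) g) n) ⟩
    f 0 * g 0 * h (suc n) + (conv (λ i → f 0 * g (suc i)) h n + conv (conv (f ∘ suc) g) h n)
      ≈⟨ +-congˡ (+-cong (conv-scaleˡ (f 0) (g ∘ suc) h n) (conv-assoc (f ∘ suc) g h n)) ⟩
    f 0 * g 0 * h (suc n) + (f 0 * conv (g ∘ suc) h n + conv (f ∘ suc) (conv g h) n)
      ≈⟨ solve 5 (λ a b c d e → a :* b :* c :+ (a :* d :+ e) := a :* (b :* c :+ d) :+ e) refl (f 0) (g 0) (h (suc n)) _ _ ⟩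
    f 0 * (g 0 * h (suc n) + conv (g ∘ suc) h n) + conv (f ∘ suc) (conv g h) n ∎

  seriesRing : CommutativeRing 0ℓ 0ℓ
  seriesRing = record
    { Carrier = Series
    ; _≈_ = _≋_
    ; _+_ = λ f g n → f n + g n
    ; _*_ = conv
    ; -_ = λ f n → - f n
    ; 0# = λ _ → 0#
    ; 1# = constant 1#
    ; isCommutativeRing = record
      { isRing = record
        { +-isAbelianGroup = Pointwise.isAbelianGroup ℕ +-isAbelianGroup
        ; *-cong = conv-cong
        ; *-assoc = conv-assoc
        ; *-identity = identityˡ , λ f n → trans (conv-comm f (constant 1#) n) (identityˡ f n)
        ; distrib = (λ h f g n → trans (conv-comm h _ n) (trans (conv-distribʳ h f g n) (+-cong (conv-comm f h n) (conv-comm g h n))))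
                  , conv-distribʳ
        }
      ; *-comm = conv-comm
      }
    }
    where
    identityˡ : ∀ f → conv (constant 1#) f ≋ f
    identityˡ f n = trans (conv-constantˡ 1# f n) (*-identityˡ (f n))

  -- From g₀ f₀ = 0 follows g₀ = 0, and then the shifted series `g ∘ suc` satisfies the same
  -- equation, so the coefficients vanish one after another.
  conv-cancel-unit : ∀ f g → ¬ f 0 ≈ 0# → (∀ n → conv g f n ≈ 0#) → ∀ n → g n ≈ 0#
  conv-cancel-unit f g f₀≉0 fg≈0 zero    = *-cancel f₀≉0 (trans (*-comm _ _) (fg≈0 0))
  conv-cancel-unit f g f₀≉0 fg≈0 (suc n) = conv-cancel-unit f (g ∘ suc) f₀≉0
    (λ i → trans (sym (+-identityˡ _)) (trans (+-congʳ (sym (zero-* _ (conv-cancel-unit f g f₀≉0 fg≈0 0)))) (fg≈0 (suc i)))) n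

  -- If g₀ were nonzero, f would vanish; hence g₀ = 0 and g can be divided by x.
  conv-cancel : ∀ f g → ¬ (∀ n → f n ≈ 0#) → (∀ n → conv g f n ≈ 0#) → ∀ n → g n ≈ 0#
  conv-cancel f g f≉0 gf≈0 = go
    where
    g₀≈0 : g 0 ≈ 0#
    g₀≈0 = ≈-stable λ g₀≉0 → f≉0 (conv-cancel-unit g f g₀≉0 (λ n → trans (conv-comm f g n) (gf≈0 n)))

    go : ∀ n → g n ≈ 0#
    go zero    = g₀≈0
    go (suc n) = conv-cancel f (g ∘ suc) f≉0
      (λ i → trans (sym (+-identityˡ _)) (trans (+-congʳ (sym (zero-* _ g₀≈0))) (gf≈0 (suc i)))) n

  series : Domain
  series = record
    { commutativeRing = seriesRing
    ; 1≉0 = λ eq → 1≉0 (eq 0)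
    ; ≈-stable = λ ¬¬eq n → ≈-stable (λ ne → ¬¬eq (λ eq → ne (eq n)))
    ; *-cancel = λ {f} {g} f≉0 fg≈0 → conv-cancel f g f≉0 (λ n → trans (conv-comm g f n) (fg≈0 n))
    }

module Generic (D : Domain) where
  open Linear D
  open Exterior D using (many⇒¬Indep; Crossing)
  open PowerSeries D using (constant; conv; conv-comm; conv-constantˡ)
  open PowerSeries D public using (series)
  module S = Linear series
  open S using () renaming (_≈_ to _≋_; _*_ to _⊛_)
  module SE = Exterior series
  open import Relation.Binary.Reasoning.Setoid S.setoid

  const : ∀ {m n} → (Fin m → Vect n) → Fin m → S.Vect n
  const X i a = constant (X i a)

  constant-cong : ∀ {x y} → x ≈ y → constant x ≋ constant y
  constant-cong x≈y zero    = x≈y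
  constant-cong x≈y (suc n) = refl

  constant-* : ∀ x y → constant x ⊛ constant y ≋ constant (x * y)
  constant-* x y zero    = refl
  constant-* x y (suc n) = trans (conv-constantˡ x (constant y) (suc n)) (zeroʳ x)

  sum-coeff : ∀ {m} (f : Fin m → S.Carrier) n → S.sum f n ≈ sum (λ i → f i n)
  sum-coeff {zero}  f n = refl
  sum-coeff {suc m} f n = +-congˡ (sum-coeff (f ∘ suc) n)

  sum-constant : ∀ {m} (f : Fin m → Carrier) → S.sum (λ i → constant (f i)) ≋ constant (sum f)
  sum-constant f zero        = sum-coeff (λ i → constant (f i)) 0
  sum-constant {m} f (suc n) = trans (sum-coeff (λ i → constant (f i)) (suc n)) (sum-replicate-zero m)

  lin-constant : ∀ {m n} (c : Fin m → Carrier) (X : Fin m → Vect n) a →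
                 S.lin (constant ∘ c) (const X) a ≋ constant (lin c X a)
  lin-constant c X a = S.trans (S.sum-cong-≋ (λ i → constant-* (c i) (X i a))) (sum-constant (λ i → c i * X i a))

  lin-coeff : ∀ {m n} (c : Fin m → S.Carrier) (X : Fin m → Vect n) a k →
              S.lin c (const X) a k ≈ lin (λ i → c i k) X a
  lin-coeff c X a k = trans (sum-coeff (λ i → c i ⊛ constant (X i a)) k) (sum-cong-≋ λ i →
    trans (conv-comm (c i) (constant (X i a)) k) (trans (conv-constantˡ (X i a) (c i) k) (*-comm (X i a) (c i k))))

  -- Between constant vectors, each power of x contributes a relation of its own over the base ring.
  Indep-const : ∀ {m n} {X : Fin m → Vect n} → Indep X → S.Indep (const X)
  Indep-const {X = X} indep c eq i k = indep (λ i → c i k) (λ a → trans (sym (lin-coeff c X a k)) (eq a k)) i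

  x^ : ℕ → S.Carrier
  x^ zero    = S.1#
  x^ (suc n) zero    = 0#
  x^ (suc n) (suc k) = x^ n k

  x^-sum : ∀ {n} (v : Vect n) b → sum (λ a → v a * x^ (toℕ a) (toℕ b)) ≈ v b
  x^-sum v zero    = trans (+-cong (*-identityʳ _) (sum-zero (λ a → zeroʳ (v (suc a))))) (+-identityʳ _)
  x^-sum v (suc b) = trans (+-cong (zeroʳ _) (x^-sum (v ∘ suc) b)) (+-identityˡ _)

  -- The generic functional (1, x, x², …); the coefficients of its value at a
  -- constant vector are the coordinates of that vector.
  generic : ∀ {n} → S.Vect n → S.Carrier
  generic v = S.sum (λ a → v a ⊛ x^ (toℕ a))

  generic-injective : ∀ {n} (v : Vect n) → generic (constant ∘ v) ≋ S.0# → ∀ a → v a ≈ 0#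
  generic-injective v eq b = trans (sym (x^-sum v b)) (trans
    (sum-cong-≋ (λ a → sym (conv-constantˡ (v a) (x^ (toℕ a)) (toℕ b))))
    (trans (sym (sum-coeff (λ a → constant (v a) ⊛ x^ (toℕ a)) (toℕ b))) (eq (toℕ b))))

  generic-cong : ∀ {n} {u v : S.Vect n} → (∀ a → u a ≋ v a) → generic u ≋ generic v
  generic-cong u≋v = S.sum-cong-≋ (λ a → S.*-congʳ (u≋v a))

  generic-lin : ∀ {m n} (c : Fin m → S.Carrier) (X : Fin m → S.Vect n) →
                generic (S.lin c X) ≋ S.sum (λ i → c i ⊛ generic (X i))
  generic-lin c X = begin
    S.sum (λ a → S.lin c X a ⊛ x^ (toℕ a))
      ≈⟨ S.sum-cong-≋ (λ a → S.*-distribʳ-sum (x^ (toℕ a)) (λ i → c i ⊛ X i a)) ⟩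
    S.sum (λ a → S.sum (λ i → c i ⊛ X i a ⊛ x^ (toℕ a)))
      ≈⟨ S.∑-comm (λ a i → c i ⊛ X i a ⊛ x^ (toℕ a)) ⟩
    S.sum (λ i → S.sum (λ a → c i ⊛ X i a ⊛ x^ (toℕ a)))
      ≈⟨ S.sum-cong-≋ (λ i → S.sum-cong-≋ (λ a → S.*-assoc (c i) (X i a) (x^ (toℕ a)))) ⟩
    S.sum (λ i → S.sum (λ a → c i ⊛ (X i a ⊛ x^ (toℕ a))))
      ≈⟨ S.sum-cong-≋ (λ i → S.sym (S.*-distribˡ-sum (c i) (λ a → X i a ⊛ x^ (toℕ a)))) ⟩
    S.sum (λ i → c i ⊛ generic (X i)) ∎

  -- The projection along the generic vector (1, x, x², …).
  project : ∀ {m n} → (Fin m → Vect (suc n)) → Fin m → S.Vect n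
  project X i a = constant (X i (suc a)) S.- constant (X i zero) ⊛ x^ (suc (toℕ a))

  lin-project : ∀ {m n} (c : Fin m → S.Carrier) (X : Fin m → Vect (suc n)) a →
                S.lin c (project X) a ≋ S.lin c (const X) (suc a) S.- S.lin c (const X) zero ⊛ x^ (suc (toℕ a))
  lin-project c X a = begin
    S.sum (λ i → c i ⊛ (constant (X i (suc a)) S.- constant (X i zero) ⊛ xa))
      ≈⟨ S.sum-cong-≋ (λ i → S.solve 4 (λ c p q x → c S.:* (p S.:- q S.:* x) S.:= c S.:* p S.:- c S.:* q S.:* x) S.refl
           (c i) (constant (X i (suc a))) (constant (X i zero)) xa) ⟩
    S.sum (λ i → c i ⊛ constant (X i (suc a)) S.- c i ⊛ constant (X i zero) ⊛ xa)
      ≈⟨ S.sum-minus (λ i → c i ⊛ constant (X i (suc a))) (λ i → c i ⊛ constant (X i zero) ⊛ xa) ⟩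
    S.lin c (const X) (suc a) S.- S.sum (λ i → c i ⊛ constant (X i zero) ⊛ xa)
      ≈⟨ S.+-congˡ (S.-‿cong (S.*-distribʳ-sum xa (λ i → c i ⊛ constant (X i zero)))) ⟨
    S.lin c (const X) (suc a) S.- S.lin c (const X) zero ⊛ xa ∎
    where xa = x^ (suc (toℕ a))

  -- A relation among the projected vectors puts μ (1, x, x², …) in the span of X
  -- for some scalar μ. If μ ≠ 0, no nonzero constant functional vanishes on X,
  -- which is impossible as there are fewer than n + 1 vectors in X.
  Indep-project : ∀ {m n} {X : Fin m → Vect (suc n)} → m ≤ n → Indep X → S.Indep (project X)
  Indep-project {m} {n} {X} m≤n indep c eq = Indep-const indep c λ a → S.trans (on-curve a) (S.zero-* _ μ≈0)
    where
    μ : S.Carrier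
    μ = S.lin c (const X) zero

    on-curve : ∀ a → S.lin c (const X) a ≋ μ ⊛ x^ (toℕ a)
    on-curve zero    = S.sym (S.*-identityʳ μ)
    on-curve (suc a) = begin
      p              ≈⟨ S.solve 2 (λ p q → p S.:= (p S.:- q) S.:+ q) S.refl p q ⟩
      (p S.- q) S.+ q ≈⟨ S.+-congʳ (lin-project c X a) ⟨
      S.lin c (project X) a S.+ q ≈⟨ S.+-congʳ (eq a) ⟩
      S.0# S.+ q     ≈⟨ S.+-identityˡ q ⟩
      q              ∎
      where
      p = S.lin c (const X) (suc a)
      q = μ ⊛ x^ (suc (toℕ a))

    μ≈0 : μ ≋ S.0#
    -- The coordinate matrix is read by rows: n + 1 rows of length m ≤ n are dependent, and a
    -- relation `ℓ` between rows is a functional vanishing on every `X i`.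
    μ≈0 = S.≈-stable λ μ≉0 → many⇒¬Indep (λ a i → X i a) (s≤s m≤n) λ ℓ killed →
      generic-injective ℓ (S.*-cancel μ≉0 (begin
        μ ⊛ generic (constant ∘ ℓ)
          ≈⟨ S.*-distribˡ-sum μ (λ a → constant (ℓ a) ⊛ x^ (toℕ a)) ⟩
        S.sum (λ a → μ ⊛ (constant (ℓ a) ⊛ x^ (toℕ a)))
          ≈⟨ S.sum-cong-≋ (λ a → S.solve 3 (λ u v w → u S.:* (v S.:* w) S.:= v S.:* (u S.:* w)) S.refl μ (constant (ℓ a)) (x^ (toℕ a))) ⟩
        S.sum (λ a → constant (ℓ a) ⊛ (μ ⊛ x^ (toℕ a)))
          ≈⟨ S.sum-cong-≋ (λ a → S.*-congˡ {constant (ℓ a)} (on-curve a)) ⟨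
        S.sum (λ a → constant (ℓ a) ⊛ S.sum (λ i → c i ⊛ constant (X i a)))
          ≈⟨ S.sum-cong-≋ (λ a → S.*-distribˡ-sum (constant (ℓ a)) (λ i → c i ⊛ constant (X i a))) ⟩
        S.sum (λ a → S.sum (λ i → constant (ℓ a) ⊛ (c i ⊛ constant (X i a))))
          ≈⟨ S.∑-comm (λ a i → constant (ℓ a) ⊛ (c i ⊛ constant (X i a))) ⟩
        S.sum (λ i → S.sum (λ a → constant (ℓ a) ⊛ (c i ⊛ constant (X i a))))
          ≈⟨ S.sum-cong-≋ (λ i → S.sum-cong-≋ (λ a → S.solve 3 (λ u v w → u S.:* (v S.:* w) S.:= v S.:* (u S.:* w)) S.refl
               (constant (ℓ a)) (c i) (constant (X i a)))) ⟩
        S.sum (λ i → S.sum (λ a → c i ⊛ (constant (ℓ a) ⊛ constant (X i a))))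
          ≈⟨ S.sum-zero (λ i → S.trans (S.sym (S.*-distribˡ-sum (c i) (λ a → constant (ℓ a) ⊛ constant (X i a))))
               (S.*-zero (c i) (S.trans (lin-constant ℓ (λ a i → X i a) i) (S.trans (constant-cong (killed i)) constant-0)))) ⟩
        S.0# ∎))
      where
      constant-0 : constant 0# ≋ S.0#
      constant-0 zero    = refl
      constant-0 (suc n) = refl

  Crossing-project : ∀ r {n} {X Y : Fin (r ℕ.+ r) → Vect (suc n)} → Crossing r X Y → SE.Crossing r (project X) (project Y)
  Crossing-project r {n} {X} {Y} (c , d , eq , c≉0) =
    constant ∘ c , constant ∘ d , eq′ , λ c≈0 → c≉0 (λ i → c≈0 i 0)
    where
    eq″ : ∀ a → S.lin (constant ∘ c) (const (X ∘ (_↑ˡ r))) a ≋ S.lin (constant ∘ d) (const (Y ∘ (r ↑ʳ_))) a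
    eq″ a = S.trans (lin-constant c (X ∘ (_↑ˡ r)) a) (S.trans (constant-cong (eq a)) (S.sym (lin-constant d (Y ∘ (r ↑ʳ_)) a)))

    eq′ : ∀ a → S.lin (constant ∘ c) (project X ∘ (_↑ˡ r)) a ≋ S.lin (constant ∘ d) (project Y ∘ (r ↑ʳ_)) a
    eq′ a = S.trans (lin-project (constant ∘ c) (X ∘ (_↑ˡ r)) a) (S.trans
      (S.+-cong (eq″ (suc a)) (S.-‿cong (S.*-congʳ (eq″ zero))))
      (S.sym (lin-project (constant ∘ d) (Y ∘ (r ↑ʳ_)) a)))

  generic-axpy : ∀ {n} s t (u v : S.Vect n) →
                 generic (λ a → s ⊛ u a S.- t ⊛ v a) ≋ s ⊛ generic u S.- t ⊛ generic v
  generic-axpy s t u v = begin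
    S.sum (λ a → (s ⊛ u a S.- t ⊛ v a) ⊛ x^ (toℕ a))
      ≈⟨ S.sum-cong-≋ (λ a → S.solve 5 (λ s t u v x → (s S.:* u S.:- t S.:* v) S.:* x S.:= s S.:* (u S.:* x) S.:- t S.:* (v S.:* x))
           S.refl s t (u a) (v a) (x^ (toℕ a))) ⟩
    S.sum (λ a → s ⊛ (u a ⊛ x^ (toℕ a)) S.- t ⊛ (v a ⊛ x^ (toℕ a)))
      ≈⟨ S.sum-minus (λ a → s ⊛ (u a ⊛ x^ (toℕ a))) (λ a → t ⊛ (v a ⊛ x^ (toℕ a))) ⟩
    S.sum (λ a → s ⊛ (u a ⊛ x^ (toℕ a))) S.- S.sum (λ a → t ⊛ (v a ⊛ x^ (toℕ a)))
      ≈⟨ S.+-cong (S.*-distribˡ-sum s (λ a → u a ⊛ x^ (toℕ a))) (S.-‿cong (S.*-distribˡ-sum t (λ a → v a ⊛ x^ (toℕ a)))) ⟨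
    s ⊛ generic u S.- t ⊛ generic v ∎

  height : ∀ {n} → Vect n → S.Carrier
  height v = generic (constant ∘ v)

  height-cong : ∀ {n} {u v : Vect n} → (∀ a → u a ≈ v a) → height u ≋ height v
  height-cong u≈v = generic-cong (λ a → constant-cong (u≈v a))

  -- A basis of the intersection of the span of X with the generic hyperplane.
  cut : ∀ {m n} → (Fin (suc m) → Vect n) → Fin m → S.Vect n
  cut X i a = height (X zero) ⊛ constant (X (suc i) a) S.- height (X (suc i)) ⊛ constant (X zero a)

  -- Passes from coordinates on `cut X` to coordinates on `X`. The head coefficient is the one that
  -- makes the total height zero.
  uncut : ∀ {m n} → (Fin (suc m) → Vect n) → (Fin m → S.Carrier) → Fin (suc m) → S.Carrier
  uncut X c = cons (S.- S.sum (λ i → c i ⊛ height (X (suc i)))) (λ i → c i ⊛ height (X zero))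

  lin-cut : ∀ {m n} (c : Fin m → S.Carrier) (X : Fin (suc m) → Vect n) a →
            S.lin c (cut X) a ≋ S.lin (uncut X c) (const X) a
  lin-cut c X a = begin
    S.sum (λ i → c i ⊛ (h₀ ⊛ x i S.- h i ⊛ x₀))
      ≈⟨ S.sum-cong-≋ (λ i → S.solve 5 (λ c h₀ x h x₀ → c S.:* (h₀ S.:* x S.:- h S.:* x₀) S.:= c S.:* h₀ S.:* x S.:- c S.:* h S.:* x₀)
           S.refl (c i) h₀ (x i) (h i) x₀) ⟩
    S.sum (λ i → c i ⊛ h₀ ⊛ x i S.- c i ⊛ h i ⊛ x₀)
      ≈⟨ S.sum-minus (λ i → c i ⊛ h₀ ⊛ x i) (λ i → c i ⊛ h i ⊛ x₀) ⟩
    A S.- S.sum (λ i → c i ⊛ h i ⊛ x₀)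
      ≈⟨ S.+-congˡ (S.-‿cong (S.*-distribʳ-sum x₀ (λ i → c i ⊛ h i))) ⟨
    A S.- S.sum (λ i → c i ⊛ h i) ⊛ x₀
      ≈⟨ S.solve 3 (λ A B x → A S.:- B S.:* x S.:= S.:- B S.:* x S.:+ A) S.refl A (S.sum (λ i → c i ⊛ h i)) x₀ ⟩
    S.- S.sum (λ i → c i ⊛ h i) ⊛ x₀ S.+ A ∎
    where
    h₀ = height (X zero)
    x₀ = constant (X zero a)
    h x : Fin _ → S.Carrier
    h i = height (X (suc i))
    x i = constant (X (suc i) a)
    A = S.sum (λ i → c i ⊛ h₀ ⊛ x i)

  height≉0 : ∀ {n} {v : Vect n} → ¬ (∀ a → v a ≈ 0#) → ¬ height v ≋ S.0#
  height≉0 {v = v} v≉0 eq = v≉0 (generic-injective v eq)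

  uncut-injective : ∀ {m n} (X : Fin (suc m) → Vect n) → ¬ (∀ a → X zero a ≈ 0#) →
                    ∀ c i → uncut X c (suc i) ≋ S.0# → c i ≋ S.0#
  uncut-injective X X₀≉0 c i eq = S.*-cancel (height≉0 X₀≉0) (S.trans (S.*-comm (height (X zero)) (c i)) eq)

  Indep-cut : ∀ {m n} {X : Fin (suc m) → Vect n} → Indep X → S.Indep (cut X)
  Indep-cut {X = X} indep c eq i = uncut-injective X (Indep⇒head≉0 X indep) c i
    (Indep-const {X = X} indep (uncut X c) (λ a → S.trans (S.sym (lin-cut c X a)) (eq a)) (suc i))

  -- A vector of the span of `X` on the generic hyperplane is a combination of `cut X` after
  -- division by the height of the pivot `X zero`; the factor on the left clears that denominator.
  ∈Span-cut : ∀ {t m n} {y : Fin (suc t) → Vect n} {X : Fin (suc m) → Vect n} → (∀ l → y l ∈Span X) →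
              ∀ l → (λ a → height (X zero) ⊛ cut y l a) S.∈Span cut X
  ∈Span-cut {y = y} {X} span l = e ∘ suc , λ a → begin
    h₀ ⊛ cut y l a
      ≈⟨ S.*-congˡ {h₀} (cut-span a) ⟩
    h₀ ⊛ (e zero ⊛ x₀ a S.+ S.lin (e ∘ suc) (const (X ∘ suc)) a)
      ≈⟨ S.distribˡ h₀ (e zero ⊛ x₀ a) (S.lin (e ∘ suc) (const (X ∘ suc)) a) ⟩
    h₀ ⊛ (e zero ⊛ x₀ a) S.+ h₀ ⊛ S.lin (e ∘ suc) (const (X ∘ suc)) a
      ≈⟨ S.+-cong (S.solve 3 (λ h e x → h S.:* (e S.:* x) S.:= (e S.:* h) S.:* x) S.refl h₀ (e zero) (x₀ a))
                  (S.sym (S.lin-scale h₀ (e ∘ suc) (const (X ∘ suc)) a)) ⟩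
    (e zero ⊛ h₀) ⊛ x₀ a S.+ S.lin (λ i → h₀ ⊛ e (suc i)) (const (X ∘ suc)) a
      ≈⟨ S.+-cong (S.*-congʳ {x₀ a} on-hyperplane′)
                  (S.lin-cong {X = const (X ∘ suc)} (λ i → S.*-comm h₀ (e (suc i))) (λ _ _ → S.refl) a) ⟩
    S.lin (uncut X (e ∘ suc)) (const X) a
      ≈⟨ lin-cut (e ∘ suc) X a ⟨
    S.lin (e ∘ suc) (cut X) a ∎
    where
    h₀ = height (X zero)
    x₀ : S.Vect _
    x₀ a = constant (X zero a)
    c : ∀ l → Fin _ → Carrier
    c l = proj₁ (span l)
    p q : S.Carrier
    p = height (y zero)
    q = height (y (suc l))

    e : Fin _ → S.Carrier
    e i = p ⊛ constant (c (suc l) i) S.- q ⊛ constant (c zero i)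

    y-span : ∀ l a → constant (y l a) ≋ S.lin (constant ∘ c l) (const X) a
    y-span l a = S.trans (constant-cong (proj₂ (span l) a)) (S.sym (lin-constant (c l) X a))

    cut-span : ∀ a → cut y l a ≋ S.lin e (const X) a
    cut-span a = begin
      p ⊛ constant (y (suc l) a) S.- q ⊛ constant (y zero a)
        ≈⟨ S.+-cong (S.*-congˡ {p} (y-span (suc l) a)) (S.-‿cong (S.*-congˡ {q} (y-span zero a))) ⟩
      p ⊛ S.lin (constant ∘ c (suc l)) (const X) a S.- q ⊛ S.lin (constant ∘ c zero) (const X) a
        ≈⟨ S.+-cong (S.lin-scale p (constant ∘ c (suc l)) (const X) a) (S.-‿cong (S.lin-scale q (constant ∘ c zero) (const X) a)) ⟨
      S.lin (λ i → p ⊛ constant (c (suc l) i)) (const X) a S.- S.lin (λ i → q ⊛ constant (c zero i)) (const X) a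
        ≈⟨ S.+-congˡ (S.lin-neg (λ i → q ⊛ constant (c zero i)) (const X) a) ⟨
      S.lin (λ i → p ⊛ constant (c (suc l) i)) (const X) a S.+ S.lin (λ i → S.- (q ⊛ constant (c zero i))) (const X) a
        ≈⟨ S.lin-+ (λ i → p ⊛ constant (c (suc l) i)) (λ i → S.- (q ⊛ constant (c zero i))) (const X) a ⟨
      S.lin e (const X) a ∎

    on-hyperplane : S.sum (λ i → e i ⊛ height (X i)) ≋ S.0#
    on-hyperplane = begin
      S.sum (λ i → e i ⊛ height (X i))       ≈⟨ generic-lin e (const X) ⟨
      generic (S.lin e (const X))            ≈⟨ generic-cong cut-span ⟨
      generic (cut y l)                      ≈⟨ generic-axpy p q (constant ∘ y (suc l)) (constant ∘ y zero) ⟩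
      p ⊛ q S.- q ⊛ p                        ≈⟨ S.solve 2 (λ p q → p S.:* q S.:- q S.:* p S.:= S.:0) S.refl p q ⟩
      S.0#                                   ∎

    -- Height zero expresses the head coefficient, times the pivot height, through the others:
    -- exactly the shape of `uncut`.
    on-hyperplane′ : e zero ⊛ h₀ ≋ S.- S.sum (λ i → e (suc i) ⊛ height (X (suc i)))
    on-hyperplane′ = begin
      u                       ≈⟨ S.solve 2 (λ u v → u S.:= (u S.:+ v) S.:- v) S.refl u v ⟩
      (u S.+ v) S.- v         ≈⟨ S.+-congʳ on-hyperplane ⟩
      S.0# S.- v              ≈⟨ S.+-identityˡ (S.- v) ⟩
      S.- v                   ∎
      where
      u = e zero ⊛ h₀
      v = S.sum (λ i → e (suc i) ⊛ height (X (suc i)))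

  Adapted-const : ∀ {p n s} {P Q : Fin p → Vect n} → Adapted s P Q → S.Adapted s (const P) (const Q)
  Adapted-const {P = P} {Q} ad = record
    { shared = λ l l<s a → constant-cong (Adapted.shared ad l l<s a)
    ; joint = λ c d d≈0 eq →
        let at k = Adapted.joint ad (λ l → c l k) (λ l → d l k) (λ l l<s → d≈0 l l<s k)
                     (λ a → trans (+-cong (sym (lin-coeff c P a k)) (sym (lin-coeff d Q a k))) (eq a k))
        in (λ l k → proj₁ (at k) l) , (λ l k → proj₂ (at k) l)
    }

  -- Both bases lose their heads, the pivots. A shared pivot keeps the other shared vectors equal
  -- and lowers s by one; with s = 0 the pivots are unrelated and the families stay jointly
  -- independent, which is why `pred` stopping at 0 is right.
  Adapted-cut : ∀ {p n s} {P Q : Fin (suc p) → Vect n} → Adapted s P Q → S.Adapted (ℕ.pred s) (cut P) (cut Q)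
  Adapted-cut {s = zero} {P} {Q} ad = record
    { shared = λ _ ()
    ; joint = λ c d _ eq →
        let zeros = S.Adapted.joint (Adapted-const ad) (uncut P c) (uncut Q d) (λ _ ())
                      (λ a → S.trans (S.sym (S.+-cong (lin-cut c P a) (lin-cut d Q a))) (eq a))
        in (λ l → uncut-injective P (Indep⇒head≉0 P (Adapted.Indepˡ ad)) c l (proj₁ zeros (suc l)))
         , (λ l → uncut-injective Q (Adapted⇒headʳ≉0 ad) d l (proj₂ zeros (suc l)))
    }
  Adapted-cut {s = suc s} {P} {Q} ad = record
    { shared = λ l l<s a → S.+-cong
        (S.*-cong (height-cong (shared zero (s≤s z≤n))) (constant-cong (shared (suc l) (s≤s l<s) a)))
        (S.-‿cong (S.*-cong (height-cong (shared (suc l) (s≤s l<s))) (constant-cong (shared zero (s≤s z≤n) a))))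
    ; joint = joint′
    }
    where
    open Adapted ad using (shared)

    -- The two pivots coincide, so the multiple of the second is moved onto the first.
    joint′ : ∀ c d → (∀ l → toℕ l < s → d l ≋ S.0#) → (∀ a → S.lin c (cut P) a S.+ S.lin d (cut Q) a ≋ S.0#) →
             (∀ l → c l ≋ S.0#) × (∀ l → d l ≋ S.0#)
    joint′ c d d≈0 eq = (λ l → uncut-injective P (Indep⇒head≉0 P (Adapted.Indepˡ ad)) c l (proj₁ zeros (suc l)))
                      , (λ l → uncut-injective Q (Adapted⇒headʳ≉0 ad) d l (proj₂ zeros (suc l)))
      where
      γ δ : Fin _ → S.Carrier
      γ = uncut P c
      δ = uncut Q d

      d′≈0 : ∀ l → toℕ l < suc s → cons S.0# (δ ∘ suc) l ≋ S.0#
      d′≈0 zero    _         = S.refl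
      d′≈0 (suc l) (s≤s l<s) = S.zero-* (height (Q zero)) (d≈0 l l<s)

      zeros = S.Adapted.joint (Adapted-const ad) (cons (γ zero S.+ δ zero) (γ ∘ suc)) (cons S.0# (δ ∘ suc)) d′≈0 λ a →
        let p₀ = constant (P zero a)
            q₀ = constant (Q zero a)
            p = S.lin (γ ∘ suc) (const (P ∘ suc)) a
            q = S.lin (δ ∘ suc) (const (Q ∘ suc)) a
        in begin
          ((γ zero S.+ δ zero) ⊛ p₀ S.+ p) S.+ (S.0# ⊛ q₀ S.+ q)
            ≈⟨ S.solve 6 (λ c d p₀ q₀ p q → ((c S.:+ d) S.:* p₀ S.:+ p) S.:+ (S.:0 S.:* q₀ S.:+ q)
                 S.:= (c S.:* p₀ S.:+ p) S.:+ (d S.:* p₀ S.:+ q)) S.refl (γ zero) (δ zero) p₀ q₀ p q ⟩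
          (γ zero ⊛ p₀ S.+ p) S.+ (δ zero ⊛ p₀ S.+ q)
            ≈⟨ S.+-congˡ (S.+-congʳ (S.*-congˡ {δ zero} (constant-cong (shared zero (s≤s z≤n) a)))) ⟩
          S.lin γ (const P) a S.+ S.lin δ (const Q) a
            ≈⟨ S.+-cong (lin-cut c P a) (lin-cut d Q a) ⟨
          S.lin c (cut P) a S.+ S.lin d (cut Q) a
            ≈⟨ eq a ⟩
          S.0# ∎

  -- The witnesses are cut as well and so lose one vector. Each of the two span memberships costs
  -- its own pivot height, hence the product of both as a scale factor.
  Meets-cut : ∀ {t p n} {P Q : Fin (suc p) → Vect n} → ¬ (∀ a → P zero a ≈ 0#) → ¬ (∀ a → Q zero a ≈ 0#) →
              Meets (suc t) P Q → S.Meets t (cut P) (cut Q)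
  Meets-cut {P = P} {Q} P₀≉0 Q₀≉0 (y , indep , inP , inQ) =
      (λ l a → hP ⊛ hQ ⊛ cut y l a)
    , S.Indep-scale (λ eq → height≉0 Q₀≉0 (S.*-cancel (height≉0 P₀≉0) eq)) (Indep-cut {X = y} indep)
    , (λ l → let c , eq = ∈Span-cut {y = y} {P} inP l in (λ i → hQ ⊛ c i) , λ a →
        S.trans (S.solve 3 (λ p q y → p S.:* q S.:* y S.:= q S.:* (p S.:* y)) S.refl hP hQ (cut y l a))
        (S.trans (S.*-congˡ {hQ} (eq a)) (S.sym (S.lin-scale hQ c (cut P) a))))
    , (λ l → let c , eq = ∈Span-cut {y = y} {Q} inQ l in (λ i → hP ⊛ c i) , λ a →
        S.trans (S.*-assoc hP hQ (cut y l a))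
        (S.trans (S.*-congˡ {hP} (eq a)) (S.sym (S.lin-scale hP c (cut Q) a))))
    where
    hP = height (P zero)
    hQ = height (Q zero)

-- The skew Bollobás bound in arbitrary dimension

skew-bound-disjoint : ∀ g (D : Domain) →
  let open Linear D
      open Exterior D
  in ∀ {m} r (X : Fin m → Fin (r ℕ.+ r) → Vect (g ℕ.+ (r ℕ.+ r))) →
  (∀ i → Indep (X i)) → (∀ i j → i Fin.< j → Crossing r (X i) (X j)) → m ≤ binomial (r ℕ.+ r) r
skew-bound-disjoint zero    D r X indep cross = Exterior.skew-bound-exact D r X indep cross
skew-bound-disjoint (suc g) D r X indep cross = skew-bound-disjoint g series r (project ∘ X)
  (λ i → Indep-project (ℕ.m≤n+m _ g) (indep i)) (λ i j i<j → Crossing-project r {X = X i} {X j} (cross i j i<j))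
  where open Generic D

-- After t cuts every sᵢ ≤ t has dropped to 0, while `Meets (suc t)` still provides one common
-- vector. Cutting keeps the ambient coordinates, so the dimension g + 2r is left for the
-- projections to reduce.
skew-bound : ∀ t (D : Domain) →
  let open Linear D
  in ∀ {m} g r (P Q : Fin m → Fin (t ℕ.+ r) → Vect (g ℕ.+ (r ℕ.+ r))) (s : Fin m → ℕ) →
  (∀ i → s i ≤ t) → (∀ i → Adapted (s i) (P i) (Q i)) → (∀ i j → i Fin.< j → Meets (suc t) (P i) (Q j)) →
  m ≤ binomial (r ℕ.+ r) r
skew-bound (suc t) D g r P Q s s≤t adapted meets = skew-bound t series g r (cut ∘ P) (cut ∘ Q) (ℕ.pred ∘ s)
  (λ i → ℕ.pred-mono-≤ (s≤t i)) (λ i → Adapted-cut (adapted i))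
  (λ i j i<j → Meets-cut {P = P i} {Q j} (Indep⇒head≉0 (P i) (Adapted.Indepˡ (adapted i))) (Adapted⇒headʳ≉0 (adapted j)) (meets i j i<j))
  where
  open Generic D
  open Linear D
skew-bound zero D {m} g r P Q s s≤0 adapted meets = skew-bound-disjoint g D r X indep cross
  where
  open Linear D
  open Exterior D using (Crossing)
  X : Fin m → Fin (r ℕ.+ r) → Vect (g ℕ.+ (r ℕ.+ r))
  X i = append (P i) (Q i)

  indep : ∀ i → Indep (X i)
  indep i c eq = ↑-elim r (λ l → c l ≈ 0#) (proj₁ zeros) (proj₂ zeros)
    where
    zeros = Adapted.joint (adapted i) (c ∘ (_↑ˡ r)) (c ∘ (r ↑ʳ_)) (λ l l<s → contradiction (ℕ.≤-trans l<s (s≤0 i)) λ ())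
      (λ a → trans (sym (lin-append (λ v → v) c (P i) (Q i) a)) (eq a))

  cross : ∀ i j → i Fin.< j → Crossing r (X i) (X j)
  cross i j i<j with meets i j i<j
  ... | y , y-indep , inP , inQ with inP zero | inQ zero
  ...   | c , y≈P | d , y≈Q = c , d , eq , λ c≈0 → Indep⇒head≉0 y y-indep (λ a → trans (y≈P a) (lin-zero (P i) c≈0 a))
    where
    eq : ∀ a → lin c (X i ∘ (_↑ˡ r)) a ≈ lin d (X j ∘ (r ↑ʳ_)) a
    eq a = trans (lin-cong {X = X i ∘ (_↑ˡ r)} {P i} (λ _ → refl) (λ l b → reflexive (≡.cong (λ v → v b) (append-↑ˡ (P i) (Q i) l))) a)
      (trans (sym (y≈P a)) (trans (y≈Q a)
      (lin-cong {X = Q j} {X j ∘ (r ↑ʳ_)} (λ _ → refl) (λ l b → reflexive (≡.cong (λ v → v b) (≡.sym (append-↑ʳ (P j) (Q j) l)))) a)))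

-- Subspaces over a finite field

fieldDomain : ∀ {q} → FiniteField q → Domain
fieldDomain F = record
  { commutativeRing = R
  ; 1≉0 = λ eq → 0≢1 (≡.sym eq)
  ; ≈-stable = decidable-stable (_ Fin.≟ _)
  ; *-cancel = λ {x} {y} x≢0 xy≡0 → let x⁻¹ , xx⁻¹≡1 = inverse x x≢0 in begin
      y                ≡⟨ *-identityˡ y ⟨
      1# * y           ≡⟨ *-congʳ xx⁻¹≡1 ⟨
      x * x⁻¹ * y      ≡⟨ *-congʳ (*-comm x x⁻¹) ⟩
      x⁻¹ * x * y      ≡⟨ *-assoc x⁻¹ x y ⟩
      x⁻¹ * (x * y)    ≡⟨ *-congˡ xy≡0 ⟩
      x⁻¹ * 0#         ≡⟨ zeroʳ x⁻¹ ⟩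
      0#               ∎
  }
  where
  open FiniteField F
  R : CommutativeRing 0ℓ 0ℓ
  R = record { isCommutativeRing = isCommutativeRing }
  open CommutativeRing R hiding (zero)
  open ≡.≡-Reasoning

search : ∀ {q} d {P : Vec (Fin q) d → Set} → Decidable P → Dec (∃ P)
search zero    P? = map′ ([] ,_) (λ { ([] , p) → p }) (P? [])
search (suc d) P? = map′ (λ { (x , v , p) → x ∷ v , p }) (λ { (x ∷ v , p) → x , v , p })
  (Fin.any? (λ x → search d (λ v → P? (x ∷ v))))

all-or-counterexample : ∀ {q} d {P : Vec (Fin q) d → Set} → Decidable P → (∀ x → P x) ⊎ ∃[ x ] ¬ P x
all-or-counterexample d P? with search d (λ x → ¬? (P? x))
... | yes counterexample = inj₂ counterexample
... | no none = inj₁ (λ x → decidable-stable (P? x) (λ ¬p → none (x , ¬p)))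

∧-true : ∀ {a b} → a ≡ true → b ≡ true → a ∧ b ≡ true
∧-true ≡.refl ≡.refl = ≡.refl

∧-trueˡ : ∀ {a b} → a ∧ b ≡ true → a ≡ true
∧-trueˡ {true} _ = ≡.refl

∧-trueʳ : ∀ {a b} → a ∧ b ≡ true → b ≡ true
∧-trueʳ {true} eq = eq

module Subspaces {q} (F : FiniteField q) (n : ℕ) where
  open LinearAlgebra F n
  open Linear (fieldDomain F) hiding (_≈_)
  open Exterior (fieldDomain F) using (many⇒¬Indep)
  open ≡.≡-Reasoning

  vec-ext : ∀ {u v : V} → (∀ a → lookup u a ≡ lookup v a) → u ≡ v
  vec-ext {u} {v} eq = begin
    u                    ≡⟨ Vec.tabulate∘lookup u ⟨
    tabulate (lookup u)  ≡⟨ Vec.tabulate-cong eq ⟩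
    tabulate (lookup v)  ≡⟨ Vec.tabulate∘lookup v ⟩
    v                    ∎

  lookup-0V : ∀ a → lookup 0V a ≡ 0#
  lookup-0V a = Vec.lookup-replicate a 0#

  lookup-lincomb : ∀ {d} (c : Fin d → Fin q) (b : Fin d → V) a → lookup (lincomb c b) a ≡ lin c (lookup ∘ b) a
  lookup-lincomb {zero}  c b a = lookup-0V a
  lookup-lincomb {suc d} c b a = begin
    lookup ((c zero ·V b zero) +V lincomb (c ∘ suc) (b ∘ suc)) a
      ≡⟨ Vec.lookup-zipWith _+_ a (c zero ·V b zero) (lincomb (c ∘ suc) (b ∘ suc)) ⟩
    lookup (c zero ·V b zero) a + lookup (lincomb (c ∘ suc) (b ∘ suc)) a
      ≡⟨ ≡.cong₂ _+_ (Vec.lookup-map a (c zero *_) (b zero)) (lookup-lincomb (c ∘ suc) (b ∘ suc) a) ⟩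
    c zero * lookup (b zero) a + lin (c ∘ suc) (lookup ∘ b ∘ suc) a ∎

  LI⇒Indep : ∀ {d} {b : Fin d → V} → LinearlyIndependent b → Indep (lookup ∘ b)
  LI⇒Indep {b = b} li c eq = li c (vec-ext λ a → ≡.trans (lookup-lincomb c b a) (≡.trans (eq a) (≡.sym (lookup-0V a))))

  Indep⇒LI : ∀ {d} {b : Fin d → V} → Indep (lookup ∘ b) → LinearlyIndependent b
  Indep⇒LI {b = b} indep c eq = indep c λ a →
    ≡.trans (≡.sym (lookup-lincomb c b a)) (≡.trans (≡.cong (λ v → lookup v a) eq) (lookup-0V a))

  lincomb-cong : ∀ {d} {c c′ : Fin d → Fin q} (b : Fin d → V) → (∀ i → c i ≡ c′ i) → lincomb c b ≡ lincomb c′ b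
  lincomb-cong {zero}  b eq = ≡.refl
  lincomb-cong {suc d} b eq = ≡.cong₂ (λ x v → (x ·V b zero) +V v) (eq zero) (lincomb-cong (b ∘ suc) (eq ∘ suc))

  Spanned : ∀ {d} → (Fin d → V) → V → Set
  Spanned b x = ∃[ c ] lincomb c b ≡ x

  spanned? : ∀ {d} (b : Fin d → V) → Decidable (Spanned b)
  spanned? {d} b x = map′ (λ { (c , eq) → lookup c , eq })
    (λ { (c , eq) → tabulate c , ≡.trans (lincomb-cong b (Vec.lookup∘tabulate c)) eq })
    (search d (λ c → Vec.≡-dec Fin._≟_ (lincomb (lookup c) b) x))

  spanned⇒∈Span : ∀ {d} {b : Fin d → V} {x} → Spanned b x → lookup x ∈Span (lookup ∘ b)
  spanned⇒∈Span {b = b} (c , eq) = c , λ a → ≡.trans (≡.cong (λ v → lookup v a) (≡.sym eq)) (lookup-lincomb c b a)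

  ∈Span⇒spanned : ∀ {d} {b : Fin d → V} {x} → lookup x ∈Span (lookup ∘ b) → Spanned b x
  ∈Span⇒spanned {b = b} (c , eq) = c , vec-ext λ a → ≡.trans (lookup-lincomb c b a) (≡.sym (eq a))

  mem-lincomb : ∀ U {d} (c : Fin d → Fin q) (b : Fin d → V) → (∀ i → mem U (b i) ≡ true) → mem U (lincomb c b) ≡ true
  mem-lincomb U {zero}  c b b∈U = has-zero U
  mem-lincomb U {suc d} c b b∈U = add-closed U _ _ (smul-closed U _ _ (b∈U zero)) (mem-lincomb U (c ∘ suc) (b ∘ suc) (b∈U ∘ suc))

  IsBasis : Subspace → ∀ {d} → (Fin d → V) → Set
  IsBasis U b = LinearlyIndependent b × (∀ i → mem U (b i) ≡ true) × (∀ x → mem U x ≡ true → Spanned b x)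

  LI-cons : ∀ {d} {b : Fin d → V} {x} → LinearlyIndependent b → ¬ Spanned b x → LinearlyIndependent (cons x b)
  LI-cons {b = b} {x} li x∉span = Indep⇒LI {b = cons x b} indep
    where
    indep : Indep (lookup ∘ cons x b)
    indep c eq = λ { zero → c₀≡0 ; (suc i) → rest i }
      where
      c₀≡0 : c zero ≡ 0#
      c₀≡0 = ≈-stable λ c₀≢0 → let e , c₀e≡1 = FiniteField.inverse F (c zero) c₀≢0 in
        x∉span (∈Span⇒spanned {b = b} ((λ i → (- e) * c (suc i)) , λ a → let
          X = lookup x a
          L = lin (c ∘ suc) (lookup ∘ b) a in begin
          X                            ≡⟨ *-identityˡ X ⟨
          1# * X                       ≡⟨ *-congʳ c₀e≡1 ⟨
          c zero * e * X               ≡⟨ solve 4 (λ c e X L → c :* e :* X := e :* (c :* X :+ L) :+ :- e :* L) ≡.refl (c zero) e X L ⟩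
          e * (c zero * X + L) + (- e) * L ≡⟨ +-congʳ (*-zero e (eq a)) ⟩
          0# + (- e) * L               ≡⟨ +-identityˡ _ ⟩
          (- e) * L                    ≡⟨ lin-scale (- e) (c ∘ suc) (lookup ∘ b) a ⟨
          lin (λ i → (- e) * c (suc i)) (lookup ∘ b) a ∎))

      rest : ∀ i → c (suc i) ≡ 0#
      rest = LI⇒Indep {b = b} li (c ∘ suc) λ a →
        ≡.trans (≡.sym (+-identityˡ _)) (≡.trans (+-congʳ (≡.sym (zero-* (lookup x a) c₀≡0))) (eq a))

  -- The ambient space is finite, so a vector of `U` outside the span can be searched for. The basis
  -- constructions below grow their families by this dichotomy.
  basis-or-larger : ∀ U {d} (b : Fin d → V) → LinearlyIndependent b → (∀ i → mem U (b i) ≡ true) →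
                    IsBasis U b ⊎ ∃[ x ] mem U x ≡ true × LinearlyIndependent (cons x b)
  basis-or-larger U b li b∈U with search n (λ x → (mem U x Bool.≟ true) ×-dec ¬? (spanned? b x))
  ... | yes (x , x∈U , x∉span) = inj₂ (x , x∈U , LI-cons {b = b} li x∉span)
  ... | no none = inj₁ (li , b∈U , λ x x∈U → decidable-stable (spanned? b x) (λ x∉span → none (x , x∈U , x∉span)))

  -- The coordinate vectors of `b` in the given basis are independent in k-space, so `many⇒¬Indep`
  -- bounds their number.
  LI-size≤dim : ∀ U {d k} (b : Fin d → V) → LinearlyIndependent b → (∀ i → mem U (b i) ≡ true) → HasDim U k → d ≤ k
  LI-size≤dim U {d} {k} b li b∈U (e , _ , _ , spans) = ℕ.≮⇒≥ λ k<d → many⇒¬Indep Γ k<d λ c eq →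
    LI⇒Indep {b = b} li c λ a → begin
      lin c (lookup ∘ b) a
        ≡⟨ lin-cong {X = lookup ∘ b} (λ _ → ≡.refl) (λ i → proj₂ (spanned⇒∈Span {b = e} (spans (b i) (b∈U i)))) a ⟩
      lin c (λ i → lin (Γ i) (lookup ∘ e)) a    ≡⟨ lin-lin c Γ (lookup ∘ e) a ⟨
      lin (lin c Γ) (lookup ∘ e) a              ≡⟨ lin-zero (lookup ∘ e) eq a ⟩
      0#                                        ∎
    where
    Γ : Fin d → Fin k → Fin q
    Γ i = proj₁ (spans (b i) (b∈U i))

  -- `LI-cons` adds a vector in front, but `Adapted` wants the shared vectors `X` to stay in front.
  LI-append-cons : ∀ {s p} (X : Fin s → V) x (A : Fin p → V) →
                   LinearlyIndependent (cons x (append X A)) → LinearlyIndependent (append X (cons x A))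
  LI-append-cons {s} {p} X x A li = Indep⇒LI {b = append X (cons x A)} λ c eq → let
      l = c ∘ (_↑ˡ suc p)
      r = c ∘ (s ↑ʳ_)
      zeros = LI⇒Indep {b = cons x (append X A)} li (cons (r zero) (append l (r ∘ suc))) λ a → begin
        r zero * lookup x a + lin (append l (r ∘ suc)) (lookup ∘ append X A) a
          ≡⟨ ≡.cong (_ +_) (lin-append lookup (append l (r ∘ suc)) X A a) ⟩
        r zero * lookup x a + (lin (append l (r ∘ suc) ∘ (_↑ˡ p)) (lookup ∘ X) a + lin (append l (r ∘ suc) ∘ (s ↑ʳ_)) (lookup ∘ A) a)
          ≡⟨ ≡.cong (_ +_) (≡.cong₂ _+_
               (lin-cong {X = lookup ∘ X} (append-↑ˡ l (r ∘ suc)) (λ _ _ → ≡.refl) a)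
               (lin-cong {X = lookup ∘ A} (append-↑ʳ l (r ∘ suc)) (λ _ _ → ≡.refl) a)) ⟩
        r zero * lookup x a + (lin l (lookup ∘ X) a + lin (r ∘ suc) (lookup ∘ A) a)
          ≡⟨ solve 3 (λ u v w → u :+ (v :+ w) := v :+ (u :+ w)) ≡.refl (r zero * lookup x a) _ _ ⟩
        lin l (lookup ∘ X) a + (r zero * lookup x a + lin (r ∘ suc) (lookup ∘ A) a)
          ≡⟨ lin-append lookup c X (cons x A) a ⟨
        lin c (lookup ∘ append X (cons x A)) a
          ≡⟨ eq a ⟩
        0# ∎
    in ↑-elim s (λ i → c i ≡ 0#)
         (λ i → ≡.trans (≡.sym (append-↑ˡ l (r ∘ suc) i)) (zeros (suc (i ↑ˡ p))))
         (λ { zero → zeros zero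
            ; (suc i) → ≡.trans (≡.sym (append-↑ʳ l (r ∘ suc) i)) (zeros (suc (s ↑ʳ i))) })

  extend : ∀ U {k s} → HasDim U k → (X : Fin s → V) → LinearlyIndependent X → (∀ i → mem U (X i) ≡ true) →
           ∀ p → s ℕ.+ p ≤ k → Σ (Fin p → V) λ A → LinearlyIndependent (append X A) × (∀ i → mem U (append X A i) ≡ true)
  extend U {k} {s} dim X li X∈U zero _ = (λ ()) , Indep⇒LI {b = append X (λ ())} indep
    , append-all (λ x → mem U x ≡ true) X (λ ()) X∈U (λ ())
    where
    indep : Indep (lookup ∘ append X (λ ()))
    indep c eq = ↑-elim s (λ i → c i ≡ 0#)
      (LI⇒Indep {b = X} li (c ∘ (_↑ˡ 0)) (λ a → ≡.trans (≡.sym (+-identityʳ _)) (≡.trans (≡.sym (lin-append lookup c X (λ ()) a)) (eq a))))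
      (λ ())
  extend U {k} {s} dim X li X∈U (suc p) s+p≤k
    with extend U dim X li X∈U p (ℕ.≤-trans (ℕ.+-monoʳ-≤ s (ℕ.n≤1+n p)) s+p≤k)
  ... | A , li′ , A∈U with basis-or-larger U (append X A) li′ A∈U
  ...   | inj₂ (x , x∈U , li″) = cons x A , LI-append-cons X x A li″
          , append-all (λ x → mem U x ≡ true) X (cons x A) X∈U
              (λ { zero → x∈U
                 ; (suc i) → ≡.subst (λ v → mem U v ≡ true) (append-↑ʳ X A i) (A∈U (s ↑ʳ i)) })
  -- A basis of s + p vectors would force k ≤ s + p, although s + p + 1 ≤ k.
  ...   | inj₁ basis = contradiction
          (ℕ.≤-trans (≡.subst (_≤ k) (ℕ.+-suc s p) s+p≤k)
            (LI-size≤dim U (proj₁ dim) (proj₁ (proj₂ dim)) (proj₁ (proj₂ (proj₂ dim))) (append X A , basis)))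
          ℕ.1+n≰n

  full⇒basis : ∀ U {k} → HasDim U k → (b : Fin k → V) → LinearlyIndependent b → (∀ i → mem U (b i) ≡ true) → IsBasis U b
  full⇒basis U dim b li b∈U with basis-or-larger U b li b∈U
  ... | inj₁ basis = basis
  ... | inj₂ (x , x∈U , li′) = contradiction
    (LI-size≤dim U (cons x b) li′ (λ { zero → x∈U ; (suc i) → b∈U i }) dim) ℕ.1+n≰n

  adapted-bases : ∀ U W {k s} → HasDim U k → HasDim W k → HasDim (U ∩ W) s →
                  Σ (Fin k → V) λ P → Σ (Fin k → V) λ Q →
                  IsBasis U P × IsBasis W Q × Adapted s (lookup ∘ P) (lookup ∘ Q)
  adapted-bases U W {k} {s} dimU dimW (Z , liZ , Z∈U∩W , spanZ)
    with ℕ.m≤n⇒∃[o]m+o≡n (LI-size≤dim U Z liZ (∧-trueˡ ∘ Z∈U∩W) dimU)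
  ... | p , ≡.refl
    with extend U dimU Z liZ (∧-trueˡ ∘ Z∈U∩W) p ℕ.≤-refl | extend W dimW Z liZ (λ i → ∧-trueʳ {mem U (Z i)} (Z∈U∩W i)) p ℕ.≤-refl
  ...   | A , liP , P∈U | B , liQ , Q∈W = P , Q , full⇒basis U dimU P liP P∈U , full⇒basis W dimW Q liQ Q∈W
        , record { shared = shared ; joint = joint }
    where
    P Q : Fin (s ℕ.+ p) → V
    P = append Z A
    Q = append Z B

    low : ∀ {i} → ¬ toℕ (s ↑ʳ i) < s
    low {i} lt = ℕ.<⇒≱ lt (≡.subst (s ≤_) (≡.sym (Fin.toℕ-↑ʳ s i)) (ℕ.m≤m+n s (toℕ i)))

    shared : ∀ l → toℕ l < s → ∀ a → lookup (P l) a ≡ lookup (Q l) a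
    shared = ↑-elim s (λ l → toℕ l < s → ∀ a → lookup (P l) a ≡ lookup (Q l) a)
      (λ i _ a → ≡.cong (λ v → lookup v a) (≡.trans (append-↑ˡ Z A i) (≡.sym (append-↑ˡ Z B i))))
      (λ i lt → contradiction lt low)

    -- A common vector lies in the span of Z, and its coordinates in P and in Q are unique.
    joint : ∀ c d → (∀ l → toℕ l < s → d l ≡ 0#) → (∀ a → lin c (lookup ∘ P) a + lin d (lookup ∘ Q) a ≡ 0#) →
            (∀ l → c l ≡ 0#) × (∀ l → d l ≡ 0#)
    joint c d d≡0 eq = (λ l → ≡.trans (c≡e l) (e≡0 l)) , d≡0′
      where
      y : V
      y = lincomb c P

      y≡-dQ : lincomb (λ i → - d i) Q ≡ y
      y≡-dQ = vec-ext λ a → let u = lin c (lookup ∘ P) a ; v = lin d (lookup ∘ Q) a in begin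
        lookup (lincomb (λ i → - d i) Q) a      ≡⟨ lookup-lincomb (λ i → - d i) Q a ⟩
        lin (λ i → - d i) (lookup ∘ Q) a        ≡⟨ lin-neg d (lookup ∘ Q) a ⟩
        - v                                     ≡⟨ solve 2 (λ u v → :- v := u :- (u :+ v)) ≡.refl u v ⟩
        u - (u + v)                             ≡⟨ ≡.cong (λ z → u - z) (eq a) ⟩
        u - 0#                                  ≡⟨ ≡.cong (u +_) -0#≈0# ⟩
        u + 0#                                  ≡⟨ +-identityʳ u ⟩
        u                                       ≡⟨ lookup-lincomb c P a ⟨
        lookup y a                              ∎

      y∈Z : Spanned Z y
      y∈Z = spanZ y (∧-true (mem-lincomb U c P P∈U) (≡.subst (λ v → mem W v ≡ true) y≡-dQ (mem-lincomb W (λ i → - d i) Q Q∈W)))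

      -- The coordinates of `y` on `Z`, padded with zeros, serve for both bases since both begin
      -- with `Z`.
      e : Fin (s ℕ.+ p) → Fin q
      e = append (proj₁ y∈Z) (λ _ → 0#)

      e-span : ∀ B a → lin e (lookup ∘ append Z B) a ≡ lookup y a
      e-span B a = begin
        lin e (lookup ∘ append Z B) a
          ≡⟨ lin-append lookup e Z B a ⟩
        lin (e ∘ (_↑ˡ p)) (lookup ∘ Z) a + lin (e ∘ (s ↑ʳ_)) (lookup ∘ B) a
          ≡⟨ ≡.cong₂ _+_ (lin-cong {X = lookup ∘ Z} (append-↑ˡ (proj₁ y∈Z) (λ _ → 0#)) (λ _ _ → ≡.refl) a)
                         (lin-zero (lookup ∘ B) (append-↑ʳ (proj₁ y∈Z) (λ _ → 0#)) a) ⟩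
        lin (proj₁ y∈Z) (lookup ∘ Z) a + 0#
          ≡⟨ +-identityʳ _ ⟩
        lin (proj₁ y∈Z) (lookup ∘ Z) a
          ≡⟨ lookup-lincomb (proj₁ y∈Z) Z a ⟨
        lookup (lincomb (proj₁ y∈Z) Z) a
          ≡⟨ ≡.cong (λ v → lookup v a) (proj₂ y∈Z) ⟩
        lookup y a ∎

      c≡e : ∀ l → c l ≡ e l
      c≡e = Indep-unique (LI⇒Indep {b = P} liP) c e (λ a → ≡.trans (≡.sym (lookup-lincomb c P a)) (≡.sym (e-span A a)))

      -d≡e : ∀ l → - d l ≡ e l
      -d≡e = Indep-unique (LI⇒Indep {b = Q} liQ) (λ i → - d i) e (λ a → ≡.trans (≡.sym (lookup-lincomb _ Q a))
        (≡.trans (≡.cong (λ v → lookup v a) y≡-dQ) (≡.sym (e-span B a))))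

      -- On the first s positions `e` equals -d, which is zero by assumption; beyond them it is the
      -- padding.
      e≡0 : ∀ l → e l ≡ 0#
      e≡0 = ↑-elim s (λ l → e l ≡ 0#)
        (λ i → ≡.trans (≡.sym (-d≡e (i ↑ˡ p))) (neg-zero (d≡0 (i ↑ˡ p) (≡.subst (_< s) (≡.sym (Fin.toℕ-↑ˡ i p)) (Fin.toℕ<n i)))))
        (append-↑ʳ (proj₁ y∈Z) (λ _ → 0#))

      d≡0′ : ∀ l → d l ≡ 0#
      d≡0′ l = ≡.trans (≡.sym (-‿involutive (d l))) (neg-zero (≡.trans (-d≡e l) (e≡0 l)))

  -- An independent family grows one vector at a time; if it gets stuck early, it is a basis with
  -- fewer than `d` vectors.
  small-dim-or-LI : ∀ U d → (∃[ e ] e < d × HasDim U e) ⊎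
                    (Σ (Fin d → V) λ y → LinearlyIndependent y × (∀ i → mem U (y i) ≡ true))
  small-dim-or-LI U zero = inj₂ ((λ ()) , (λ _ _ ()) , λ ())
  small-dim-or-LI U (suc d) with small-dim-or-LI U d
  ... | inj₁ (e , e<d , dim) = inj₁ (e , ℕ.m≤n⇒m≤1+n e<d , dim)
  ... | inj₂ (y , li , y∈U) with basis-or-larger U y li y∈U
  ...   | inj₁ basis = inj₁ (d , ℕ.n<1+n d , y , basis)
  ...   | inj₂ (x , x∈U , li′) = inj₂ (cons x y , li′ , λ { zero → x∈U ; (suc i) → y∈U i })

  -- Equal vertices are non-adjacent too, but then the intersection has dimension k > t. So an
  -- intersection of dimension at most t would already give adjacency.
  nonadjacent⇒LI : ∀ {t k} → t < k → (u v : Vertex k) → ¬ AdjJ (_≤ t) u v →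
                   Σ (Fin (suc t) → V) λ y → LinearlyIndependent y × (∀ i → mem (proj₁ u ∩ proj₁ v) (y i) ≡ true)
  nonadjacent⇒LI {t} {k} t<k (U , dimU) (W , dimW) ¬adj with small-dim-or-LI (U ∩ W) (suc t)
  ... | inj₂ found = found
  ... | inj₁ (e , s≤s e≤t , dim) = contradiction (U≉W , e , e≤t , dim) ¬adj
    where
    U≉W : ¬ (∀ x → mem U x ≡ mem W x)
    U≉W eq = ℕ.<⇒≱ t<k (ℕ.≤-trans
      (LI-size≤dim (U ∩ W) (proj₁ dimU) (proj₁ (proj₂ dimU))
        (λ i → let b∈U = proj₁ (proj₂ (proj₂ dimU)) i in ∧-true b∈U (≡.trans (≡.sym (eq _)) b∈U)) dim) e≤t)

skew-vertices-bound : ∀ {q} (F : FiniteField q) g r t →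
  let open LinearAlgebra F (g ℕ.+ (r ℕ.+ r))
  in ∀ {m} (u v : Fin m → Vertex (t ℕ.+ r)) →
  t < t ℕ.+ r → (∀ i → AdjJ (_≤ t) (u i) (v i)) → (∀ i j → i Fin.< j → ¬ AdjJ (_≤ t) (u i) (v j)) →
  m ≤ binomial (r ℕ.+ r) r
skew-vertices-bound F g r t {m} u v t<k adjacent skew =
  skew-bound t (fieldDomain F) g r (λ i → lookup ∘ P i) (λ i → lookup ∘ Q i) s (λ i → proj₁ (proj₂ (proj₂ (adjacent i)))) adapted meets
  where
  open LinearAlgebra F (g ℕ.+ (r ℕ.+ r))
  open Subspaces F (g ℕ.+ (r ℕ.+ r))
  open Linear (fieldDomain F) hiding (_≈_)

  s : Fin m → ℕ
  s i = proj₁ (proj₂ (adjacent i))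

  bases : ∀ i → _
  bases i = adapted-bases (proj₁ (u i)) (proj₁ (v i)) (proj₂ (u i)) (proj₂ (v i)) (proj₂ (proj₂ (proj₂ (adjacent i))))

  P Q : Fin m → Fin (t ℕ.+ r) → V
  P i = proj₁ (bases i)
  Q i = proj₁ (proj₂ (bases i))

  adapted : ∀ i → Adapted (s i) (lookup ∘ P i) (lookup ∘ Q i)
  adapted i = proj₂ (proj₂ (proj₂ (proj₂ (bases i))))

  meets : ∀ i j → i Fin.< j → Meets (suc t) (lookup ∘ P i) (lookup ∘ Q j)
  meets i j i<j with nonadjacent⇒LI t<k (u i) (v j) (skew i j i<j)
  ... | y , li , y∈ = lookup ∘ y , LI⇒Indep {b = y} li
    , (λ l → spanned⇒∈Span {b = P i} (proj₂ (proj₂ (proj₁ (proj₂ (proj₂ (bases i))))) (y l) (∧-trueˡ (y∈ l))))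
    , (λ l → spanned⇒∈Span {b = Q j} (proj₂ (proj₂ (proj₁ (proj₂ (proj₂ (proj₂ (bases j)))))) (y l)
        (∧-trueʳ {mem (proj₁ (u i)) (y l)} (y∈ l))))

-- Counting subspaces

open import Data.Nat using (_+_; _*_; _∸_; _^_)

funToFin-cong : ∀ {m n} {f g : Fin m → Fin n} → (∀ i → f i ≡ g i) → funToFin f ≡ funToFin g
funToFin-cong {zero}  eq = ≡.refl
funToFin-cong {suc m} eq = ≡.cong₂ Fin.combine (eq zero) (funToFin-cong (eq ∘ suc))

does⇒witness : ∀ {P : Set} (P? : Dec P) → does P? ≡ true → P
does⇒witness (yes p) _ = p

module Grassmannian {q} (F : FiniteField q) where
  open Linear (fieldDomain F) hiding (_+_; _*_)
  private
    module L = Linear (fieldDomain F)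

  unit : ∀ {m} → Fin m → Fin m → Fin q
  unit i j with i Fin.≟ j
  ... | yes _ = 1#
  ... | no _  = 0#

  sum-unit : ∀ {m} (f : Fin m → Fin q) i → sum (λ j → unit i j L.* f j) ≡ f i
  sum-unit f i = ≡.trans (sum-single (λ j → unit i j L.* f j) i off) diagonal
    where
    off : ∀ j → ¬ j ≡ i → unit i j L.* f j ≡ 0#
    off j j≢i with i Fin.≟ j
    ... | yes i≡j = contradiction (≡.sym i≡j) j≢i
    ... | no _    = zeroˡ (f j)
    diagonal : unit i i L.* f i ≡ f i
    diagonal with i Fin.≟ i
    ... | yes _  = *-identityˡ (f i)
    ... | no i≢i = contradiction ≡.refl i≢i

  -- A subspace of F^(n+1) either contains e₀, and is F e₀ ⊕ U, or is the graph of
  -- a functional on its projection to the last n coordinates.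
  cone : ∀ {n k} → (Fin k → Vect n) → Fin (suc k) → Vect (suc n)
  cone X = cons (cons 1# (λ _ → 0#)) (λ i → cons 0# (X i))

  graph : ∀ {n k} → (Fin k → Fin q) → (Fin k → Vect n) → Fin k → Vect (suc n)
  graph φ X i = cons (φ i) (X i)

  -- Bases indexed along the two summands of `gauss`. The factor q ^ suc k counts the functionals on
  -- a space of dimension k + 1 by their values on its basis, decoded by `finToFun`.
  families : ∀ n k → Fin (gauss q n k) → Fin k → Vect n
  families-split : ∀ n k → Fin (gauss q n k) ⊎ Fin (q ^ suc k * gauss q n (suc k)) → Fin (suc k) → Vect (suc n)
  families n       zero    _ ()
  families (suc n) (suc k) i = families-split n k (splitAt (gauss q n k) i)
  families-split n k (inj₁ i) = cone (families n k i)
  families-split n k (inj₂ i) = let φ , j = remQuot (gauss q n (suc k)) i in graph (finToFun φ) (families n (suc k) j)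

  cone-indep : ∀ {n k} {X : Fin k → Vect n} → Indep X → Indep (cone X)
  cone-indep {X = X} indep c eq = λ { zero → c₀≡0 ; (suc i) → rest i }
    where
    rest : ∀ i → c (suc i) ≡ 0#
    rest = indep (c ∘ suc) λ a → ≡.trans (≡.sym (≡.trans (+-congʳ (zeroʳ (c zero))) (+-identityˡ _))) (eq (suc a))
    c₀≡0 : c zero ≡ 0#
    c₀≡0 = ≡.trans (≡.sym (≡.trans (+-cong (*-identityʳ (c zero)) (sum-zero (λ i → zeroʳ (c (suc i))))) (+-identityʳ _))) (eq zero)

  graph-indep : ∀ {n k} φ {X : Fin k → Vect n} → Indep X → Indep (graph φ X)
  graph-indep φ indep c eq = indep c (eq ∘ suc)

  families-indep : ∀ n k i → Indep (families n k i)
  families-split-indep : ∀ n k i → Indep (families-split n k i)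
  families-indep n       zero    i c eq ()
  families-indep (suc n) (suc k) i = families-split-indep n k (splitAt (gauss q n k) i)
  families-split-indep n k (inj₁ i) = cone-indep {X = families n k i} (families-indep n k i)
  families-split-indep n k (inj₂ i) = let φ , j = remQuot (gauss q n (suc k)) i in
    graph-indep (finToFun φ) {families n (suc k) j} (families-indep n (suc k) j)

  _≅_ : ∀ {n k} → (Fin k → Vect n) → (Fin k → Vect n) → Set
  X ≅ Y = (∀ l → X l ∈Span Y) × (∀ l → Y l ∈Span X)

  cone-cancel : ∀ {n k} {X Y : Fin k → Vect n} → cone X ≅ cone Y → X ≅ Y
  cone-cancel (X⊆Y , Y⊆X) = half X⊆Y , half Y⊆X
    where
    half : ∀ {n k} {X Y : Fin k → Vect n} → (∀ l → cone X l ∈Span cone Y) → ∀ l → X l ∈Span Y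
    half X⊆Y l = let c , eq = X⊆Y (suc l) in
      c ∘ suc , λ a → ≡.trans (eq (suc a)) (≡.trans (+-congʳ (zeroʳ (c zero))) (+-identityˡ _))

  graph-cancel : ∀ {n k} {φ ψ} {X Y : Fin k → Vect n} → graph φ X ≅ graph ψ Y → X ≅ Y
  graph-cancel (X⊆Y , Y⊆X) = (λ l → proj₁ (X⊆Y l) , λ a → proj₂ (X⊆Y l) (suc a)) , (λ l → proj₁ (Y⊆X l) , λ a → proj₂ (Y⊆X l) (suc a))

  -- The last n coordinates determine the coefficients of the l-th vector as the unit vector l, so
  -- the first coordinate compares `φ l` with `ψ l`.
  graph-functional : ∀ {n k} {φ ψ} {X : Fin k → Vect n} → Indep X → graph φ X ≅ graph ψ X → ∀ l → φ l ≡ ψ l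
  graph-functional {φ = φ} {ψ} {X} indep (X⊆Y , _) l = let c , eq = X⊆Y l in
    ≡.trans (eq zero) (≡.trans
      (sum-cong-≋ (λ j → *-congʳ (Indep-unique indep c (unit l)
        (λ a → ≡.trans (≡.sym (eq (suc a))) (≡.sym (sum-unit (λ j → X j a) l))) j)))
      (sum-unit ψ l))

  -- The cone contains e₀, whereas a vector of the graph whose last n coordinates vanish is zero.
  cone≇graph : ∀ {n k} {φ} {X : Fin k → Vect n} {Y : Fin (suc k) → Vect n} → Indep Y → ¬ cone X ≅ graph φ Y
  cone≇graph {φ = φ} {Y = Y} indep (X⊆Y , _) = let c , eq = X⊆Y zero in
    1≉0 (≡.trans (eq zero) (sum-zero λ i → zero-* (φ i) (indep c (λ a → ≡.sym (eq (suc a))) i)))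

  families-injective : ∀ n k i j → families n k i ≅ families n k j → i ≡ j
  families-split-injective : ∀ n k i j → families-split n k i ≅ families-split n k j → i ≡ j
  families-injective n zero zero zero _ = ≡.refl
  families-injective (suc n) (suc k) i j eq = begin
    i                                                     ≡⟨ Fin.join-splitAt (gauss q n k) _ i ⟨
    Fin.join (gauss q n k) _ (splitAt (gauss q n k) i)
      ≡⟨ ≡.cong (Fin.join _ _) (families-split-injective n k (splitAt _ i) (splitAt _ j) eq) ⟩
    Fin.join (gauss q n k) _ (splitAt (gauss q n k) j)    ≡⟨ Fin.join-splitAt (gauss q n k) _ j ⟩
    j                                                     ∎
    where open ≡.≡-Reasoning
  families-split-injective n k (inj₁ i) (inj₁ j) eq =
    ≡.cong inj₁ (families-injective n k i j (cone-cancel {X = families n k i} {families n k j} eq))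
  families-split-injective n k (inj₁ i) (inj₂ j) eq = let φ , j′ = remQuot (gauss q n (suc k)) j in
    contradiction eq (cone≇graph {φ = finToFun φ} {families n k i} {families n (suc k) j′} (families-indep n (suc k) j′))
  families-split-injective n k (inj₂ i) (inj₁ j) (sub , sup) = let φ , i′ = remQuot (gauss q n (suc k)) i in
    contradiction (sup , sub) (cone≇graph {φ = finToFun φ} {families n k j} {families n (suc k) i′} (families-indep n (suc k) i′))
  families-split-injective n k (inj₂ i) (inj₂ j) eq = ≡.cong inj₂ (begin
    i                    ≡⟨ Fin.combine-remQuot {q ^ suc k} G i ⟨
    Fin.combine φ i′     ≡⟨ ≡.cong₂ Fin.combine φ≡ψ i′≡j′ ⟩
    Fin.combine ψ j′     ≡⟨ Fin.combine-remQuot {q ^ suc k} G j ⟩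
    j                    ∎)
    where
    open ≡.≡-Reasoning
    G = gauss q n (suc k)
    φ = proj₁ (remQuot {q ^ suc k} G i)
    i′ = proj₂ (remQuot {q ^ suc k} G i)
    ψ = proj₁ (remQuot {q ^ suc k} G j)
    j′ = proj₂ (remQuot {q ^ suc k} G j)
    i′≡j′ : i′ ≡ j′
    i′≡j′ = families-injective n (suc k) i′ j′
      (graph-cancel {φ = finToFun φ} {finToFun ψ} {families n (suc k) i′} {families n (suc k) j′} eq)
    φ≡ψ : φ ≡ ψ
    φ≡ψ = begin
      φ                                            ≡⟨ Fin.funToFin-finToFin {suc k} {q} φ ⟨
      funToFin {suc k} {q} (finToFun φ)            ≡⟨ funToFin-cong (graph-functional {φ = finToFun φ} {finToFun ψ} {X} X-indep same-base) ⟩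
      funToFin {suc k} {q} (finToFun ψ)            ≡⟨ Fin.funToFin-finToFin {suc k} {q} ψ ⟩
      ψ                                            ∎
      where
      X = families n (suc k) i′
      X-indep = families-indep n (suc k) i′
      same-base : graph (finToFun φ) X ≅ graph (finToFun ψ) X
      same-base = ≡.subst (λ l → graph (finToFun φ) X ≅ graph (finToFun ψ) (families n (suc k) l)) (≡.sym i′≡j′) eq

module Vertices {q} (F : FiniteField q) (n : ℕ) where
  open LinearAlgebra F n
  open Subspaces F n
  open Linear (fieldDomain F) hiding (_≈_; _+_; _*_)
  private
    module L = Linear (fieldDomain F)
  open Grassmannian F

  spanned⇒mem : ∀ {d} (b : Fin d → V) {x} → Spanned b x → does (spanned? b x) ≡ true
  spanned⇒mem b {x} s = dec-true (spanned? b x) s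

  mem⇒spanned : ∀ {d} (b : Fin d → V) {x} → does (spanned? b x) ≡ true → Spanned b x
  mem⇒spanned b {x} = does⇒witness (spanned? b x)

  span : ∀ {d} → (Fin d → V) → Subspace
  span b = record
    { mem = λ x → does (spanned? b x)
    ; has-zero = spanned⇒mem b (∈Span⇒spanned {b = b} ((λ _ → 0#) , λ a →
        ≡.trans (lookup-0V a) (≡.sym (lin-zero (lookup ∘ b) (λ _ → ≡.refl) a))))
    ; add-closed = λ x y x∈ y∈ → let c , x≡ = spanned⇒∈Span {b = b} (mem⇒spanned b x∈) ; d , y≡ = spanned⇒∈Span {b = b} (mem⇒spanned b y∈) in
        spanned⇒mem b (∈Span⇒spanned {b = b} ((λ i → c i L.+ d i) , λ a →
          ≡.trans (Vec.lookup-zipWith L._+_ a x y) (≡.trans (≡.cong₂ L._+_ (x≡ a) (y≡ a)) (≡.sym (lin-+ c d (lookup ∘ b) a)))))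
    ; smul-closed = λ s x x∈ → let c , x≡ = spanned⇒∈Span {b = b} (mem⇒spanned b x∈) in
        spanned⇒mem b (∈Span⇒spanned {b = b} ((λ i → s L.* c i) , λ a →
          ≡.trans (Vec.lookup-map a (s L.*_) x) (≡.trans (≡.cong (s L.*_) (x≡ a)) (≡.sym (lin-scale s c (lookup ∘ b) a)))))
    }

  member⇒spanned : ∀ {d} (b : Fin d → V) l → Spanned b (b l)
  member⇒spanned b l = ∈Span⇒spanned {b = b} (unit l , λ a → ≡.sym (sum-unit (λ j → lookup (b j) a) l))

  vertex : ∀ {k} (b : Fin k → V) → LinearlyIndependent b → Vertex k
  vertex b li = span b , b , li , (λ l → spanned⇒mem b (member⇒spanned b l)) , (λ x x∈ → mem⇒spanned b x∈)

  toV : ∀ {k} → (Fin k → Vect n) → Fin k → V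
  toV X l = tabulate (X l)

  lookup-toV : ∀ {k} (X : Fin k → Vect n) l a → lookup (toV X l) a ≡ X l a
  lookup-toV X l = Vec.lookup∘tabulate (X l)

  vertices : ∀ k → Fin (gauss q n k) → Vertex k
  vertices k i = vertex (toV X) (Indep⇒LI {b = toV X} λ c eq → families-indep n k i c λ a →
      ≡.trans (lin-cong {X = X} (λ _ → ≡.refl) (λ l b → ≡.sym (lookup-toV X l b)) a) (eq a))
    where X = families n k i

  vertices-injective : ∀ k i j → vertices k i ≈ vertices k j → i ≡ j
  vertices-injective k i j eq = families-injective n k i j (sub i j eq , sub j i (λ x → ≡.sym (eq x)))
    where
    sub : ∀ i j → vertices k i ≈ vertices k j → ∀ l → families n k i l ∈Span families n k j
    sub i j eq l = let
        X = families n k i ; Y = families n k j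
        c , eqs = spanned⇒∈Span {b = toV Y} (mem⇒spanned (toV Y)
          (≡.trans (≡.sym (eq (toV X l))) (spanned⇒mem (toV X) (member⇒spanned (toV X) l))))
      in c , λ a → ≡.trans (≡.sym (lookup-toV X l a)) (≡.trans (eqs a) (lin-cong {X = lookup ∘ toV Y} (λ _ → ≡.refl) (lookup-toV Y) a))

  _≈?_ : ∀ {k} → Decidable₂ (_≈_ {k})
  u ≈? v with all-or-counterexample n (λ x → mem (proj₁ u) x Bool.≟ mem (proj₁ v) x)
  ... | inj₁ eq = yes eq
  ... | inj₂ (x , ne) = no (λ eq → ne (eq x))

-- Zero forcing

module ForcingOrder {A : Set} (_≈_ : A → A → Set) (Adj : A → A → Set)
  (≈-sym : ∀ {u v} → u ≈ v → v ≈ u) (≈-trans : ∀ {u v w} → u ≈ v → v ≈ w → u ≈ w) (_≈?_ : ∀ u v → Dec (u ≈ v)) where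
  open ZeroForcing _≈_ Adj

  _∈?_ : ∀ v L → Dec (v ∈L L)
  v ∈? L = any? (_≈? v) L

  uncovered : ∀ {N} (f : Fin N → A) → (∀ i j → f i ≈ f j → i ≡ j) → ∀ L → length L < N → ∃[ i ] ¬ f i ∈L L
  uncovered f f-inj L lt with Fin.all? (λ i → f i ∈? L)
  ... | no ¬all = Fin.¬∀⟶∃¬ _ _ (λ i → f i ∈? L) ¬all
  ... | yes all with Fin.pigeonhole lt (λ i → index (all i))
  ...   | i , j , i<j , eq = contradiction
    (f-inj i j (≈-trans (≈-sym (lookup-index (all i))) (≡.subst (λ l → List.lookup L l ≈ f j) (≡.sym eq) (lookup-index (all j)))))
    (Fin.<⇒≢ i<j)

  Force : List A → Set
  Force L = ∃[ u ] ∃[ v ] ¬ v ∈L L × Adj u v × (∀ w → Adj u w → ¬ w ≈ v → w ∈L L)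

  force-exists : ∀ {B} L → (∀ v → v ∈L B → v ∈L L) → ∀ {v} → Black (_∈L B) v → ¬ v ∈L L → ¬ ¬ Force L
  force-exists L B⊆L (initial v∈B) v∉L _ = v∉L (B⊆L _ v∈B)
  force-exists L B⊆L {v} (force u _ adj rest) v∉L none = none (u , v , v∉L , adj , λ w adj′ w≉v →
    decidable-stable (w ∈? L) λ w∉L → force-exists L B⊆L (rest w adj′ w≉v) w∉L none)

  Skew : ∀ {m} → (Fin m → A) → (Fin m → A) → Set
  Skew u v = (∀ i → Adj (u i) (v i)) × (∀ i j → i Fin.< j → ¬ Adj (u i) (v j))

  -- `L` is the set that is black so far. The bound on its length leaves a white value of `f` for
  -- every remaining force, and the clause that all later vᵢ avoid `L` carries the skewness through
  -- the recursion.
  skew-forces : ∀ {B N} → IsZeroForcingSet B → (f : Fin N → A) → (∀ i j → f i ≈ f j → i ≡ j) →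
                ∀ m L → (∀ v → v ∈L B → v ∈L L) → length L + m ≤ N →
                ¬ ¬ (Σ (Fin m → A) λ u → Σ (Fin m → A) λ v → Skew u v × (∀ i → ¬ v i ∈L L))
  skew-forces forcing f f-inj zero L B⊆L le none = none ((λ ()) , (λ ()) , ((λ ()) , λ ()) , λ ())
  skew-forces {N = N} forcing f f-inj (suc m) L B⊆L le none =
    let i , fi∉L = uncovered f f-inj L (ℕ.≤-trans (s≤s (ℕ.m≤m+n (length L) m)) (≡.subst (_≤ N) (ℕ.+-suc (length L) m) le))
    in force-exists L B⊆L (forcing (f i)) fi∉L λ { (u , v , v∉L , adj , rest) →
       skew-forces forcing f f-inj m (v ∷ L) (λ w w∈B → there (B⊆L w w∈B)) (≡.subst (_≤ N) (ℕ.+-suc (length L) m) le)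
         λ { (us , vs , (adjs , skew) , vs∉L) → none
             ( cons u us , cons v vs
             , ( (λ { zero → adj ; (suc i) → adjs i })
               -- If u were adjacent to a later vⱼ, then vⱼ would be v itself or, by `rest`, a
               -- member of `L`; but vⱼ is still white after v has been added.
               , (λ { zero (suc j) _ adj′ → vs∉L j (there (rest (vs j) adj′ (λ vsj≈v → vs∉L j (here (≈-sym vsj≈v)))))
                    ; (suc i) (suc j) (s≤s i<j) → skew i j i<j }))
             , (λ { zero → v∉L ; (suc i) → vs∉L i ∘ there })) } }

-- From the number of forces to the size of the forcing set

binomial≡C : ∀ n k → binomial n k ≡ n C k
binomial≡C n       zero    = ≡.sym (≡.trans (nCk≡nC[n∸k] {0} {n} z≤n) (nCn≡1 n))
binomial≡C zero    (suc k) = ≡.refl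
binomial≡C (suc n) (suc k) = ≡.trans (≡.cong₂ _+_ (binomial≡C n k) (binomial≡C n (suc k))) (nCk+nC[k+1]≡[n+1]C[k+1] n k)

theorem4p8 : (q : ℕ) (F : FiniteField q) (n k t : ℕ)
    → 1 ≤ k → 2 * k + 1 ≤ n → t < k
    → let open LinearAlgebra F n
          open ZeroForcing (_≈_ {k}) (AdjJ (λ d → d ≤ t) {k})
      in (B : List (Vertex k)) → Distinct B → IsZeroForcingSet B
      → gauss q n k ∸ ((2 * k ∸ 2 * t) C (k ∸ t)) ≤ length B
theorem4p8 q F n k t 1≤k 2k<n t<k B _ forcing
  with ℕ.m≤n⇒∃[o]m+o≡n (ℕ.<⇒≤ t<k)
... | r , ≡.refl
  -- With k = t + r, the chain 2r ≤ 2k + 1 ≤ n yields n = g + 2r, where g is the number of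
  -- projections to be made.
  with ℕ.m≤n⇒∃[o]m+o≡n (ℕ.≤-trans (ℕ.≤-trans (ℕ.+-mono-≤ (ℕ.m≤n+m r t) (ℕ.m≤n+m r t))
         (ℕ.≤-trans (ℕ.+-monoʳ-≤ (t + r) (ℕ.m≤m+n (t + r) 0)) (ℕ.m≤m+n (2 * (t + r)) 1))) 2k<n)
... | g , r+r+g≡n with ≡.trans (ℕ.+-comm g (r + r)) r+r+g≡n
-- The goal is a negation, so the doubly negated family of bound + 1 forces can be used.
... | ≡.refl = ℕ.≮⇒≥ λ short →
  skew-forces forcing (vertices (t + r)) (vertices-injective (t + r)) (suc bound) B (λ _ v∈B → v∈B) (room short)
    λ { (u , v , (adjacent , skew) , _) →
        ℕ.<⇒≱ (ℕ.n<1+n bound) (≡.subst (suc bound ≤_) binomial≡bound (skew-vertices-bound F g r t u v t<k adjacent skew)) }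
  where
  open LinearAlgebra F (g + (r + r))
  open Vertices F (g + (r + r))
  open ForcingOrder (_≈_ {t + r}) (AdjJ (_≤ t)) (λ eq x → ≡.sym (eq x)) (λ eq eq′ x → ≡.trans (eq x) (eq′ x)) _≈?_

  N = gauss q (g + (r + r)) (t + r)
  bound = (2 * (t + r) ∸ 2 * t) C (t + r ∸ t)

  binomial≡bound : binomial (r + r) r ≡ bound
  binomial≡bound = ≡.trans (binomial≡C (r + r) r) (≡.cong₂ _C_
    (≡.sym (≡.trans (≡.sym (ℕ.*-distribˡ-∸ 2 (t + r) t)) (≡.trans (≡.cong (2 *_) (ℕ.m+n∸m≡n t r)) (≡.cong (r +_) (ℕ.+-identityʳ r)))))
    (≡.sym (ℕ.m+n∸m≡n t r)))

  room : length B < N ∸ bound → length B + suc bound ≤ N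
  room short = begin
    length B + suc bound     ≡⟨ ℕ.+-suc (length B) bound ⟩
    suc (length B) + bound   ≤⟨ ℕ.+-monoˡ-≤ bound short ⟩
    -- The truncated difference exceeds `length B`, so it is nonzero and the subtraction is exact.
    N ∸ bound + bound        ≡⟨ ℕ.m∸n+n≡m {N} {bound} (ℕ.<⇒≤ (ℕ.m∸n≢0⇒n<m {N} {bound} λ eq → ℕ.n≮0 (≡.subst (length B <_) eq short))) ⟩
    N                        ∎
    where open ℕ.≤-Reasoning
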